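{- Let $n\ge 3$, let $u,w\in S^D_n$, and let $j'\in S^D_{n-1}$ be the join, in the weak order of $S^D_{n-1}$, of the parabolic projections of $u$ and $w$ to $S^D_{n-1}$. For $p\in\{\pm1,\ldots,\pm n\}$ define $j^{(p)}\in S^D_n$ in window notation as follows, where $j'_i=j'(i)$: for $p>0$, $j^{(p)}$ is obtained from the window $j'_1j'_2\cdots j'_{n-1}$ by inserting $n$ so that it occupies position $p$; for $p<0$, $j^{(p)}$ is obtained from the modified window $\overline{j'_1}\,j'_2\cdots j'_{n-1}$ (the sign of the first entry flipped) by inserting $\overline{n}$ so that it occupies position $|p|$. Then the join $u\vee w$ in the weak order of $S^D_n$ equals $j^{(p)}$, where $p$ is the largest element of $\{\pm1,\ldots,\pm n\}$ such that the following condition holds for $j=j^{(p)}$: whenever $k\in\pm[n-1]$ occurs to the right of $n$ in the complete notation of $u$ or of $w$, then $k$ occurs to the right of $n$ in the complete notation of $j$.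
   Context: For $n\ge2$, $S^D_n$ is the group of even signed permutations of $[n]=\{1,\ldots,n\}$: permutations $w$ of $\pm[n]=\{\pm1,\ldots,\pm n\}$ with $w(-i)=-w(i)$ and an even number of negative values among $w(1),\ldots,w(n)$. Write $\overline{i}$ for $-i$. It is a Coxeter group (with product given by composition of maps) with generators $S=\{s_0,\ldots,s_{n-1}\}$, $s_0=(\overline2\ 1)(\overline1\ 2)$ and $s_i=(\overline{i+1}\ \overline i)(i\ i+1)$ for $1\le i\le n-1$. For $n\geq 3$ and $I=\{s_0,\ldots,s_{n-2}\}$ the standard parabolic subgroup generated by $I$ is $S^D_{n-1}$ (elements fixing $n$). The window notation of $w$ is $w(1)w(2)\cdots w(n)$ and the complete notation is $w(-n)\cdots w(-1)\mid w(1)\cdots w(n)$; thus $k$ occurs to the right of $n$ in the complete notation of $w$ iff $w^{ -1}(k)>w^{ -1}(n)$. The (right) weak order on a finite Coxeter group is: $u\le w$ iff $T_L(u)\subseteq T_L(w)$, where $T_L(w)$ is the set of reflections $t$ with $\ell(tw)<\ell(w)$; it is a lattice. The parabolic projection of $w\in S^D_n$ to $S^D_{n-1}$ is the unique element $w_I\in S^D_{n-1}$ such that $w=w_I\,{}^Iw$ with $\ell(s\,{}^Iw)>\ell({}^Iw)$ for all $s\in I$. -}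

module Defs where

open import Algebra.Bundles using (Group)
open import Data.Fin.Base using (Fin; zero; suc; inject₁; fromℕ; toℕ; punchIn; punchOut)
open import Data.Fin.Permutation using (Permutation; Permutation′; permutation; transpose; _⟨$⟩ʳ_; _⟨$⟩ˡ_; inverseˡ; inverseʳ)
open import Data.Fin.Properties using (_≟_; punchIn-punchOut)
open import Data.Fin.Relation.Unary.Top using (View; view; ‵fromℕ; ‵inj₁; view-fromℕ; view-inject₁)
open import Data.Integer.Base as ℤ using (ℤ; _◃_)
open import Data.List.Base using (List; foldr; length)
open import Data.Nat.Base as ℕ using (ℕ; zero; suc; _+_)
open import Data.Nat.Divisibility using (_∣_; divides; _∣0; ∣-refl; ∣m∣n⇒∣m+n)
import Data.Nat.Properties as ℕ
open import Data.Product.Base using (_×_; _,_; ∃; ∃₂; proj₁; proj₂)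
open import Data.Sign.Base as Sign using (Sign; opposite)
import Data.Sign.Properties as Sign
open import Data.Sum.Base using (_⊎_)
open import Data.Vec.Functional using (Vector; map; insertAt; updateAt)
open import Data.Vec.Functional.Properties using (insertAt-lookup; insertAt-punchIn)
open import Function.Base using (_∘_)
open import Function.Bundles using (_↔_; mk↔ₛ′; module Inverse)
open import Function.Construct.Composition using (_↔-∘_)
open import Function.Construct.Identity using (↔-id)
open import Function.Construct.Symmetry using (↔-sym)
open import Level using (0ℓ)
open import Relation.Binary.PropositionalEquality
open import Relation.Nullary using (yes; no)
open import Relation.Unary using (Pred; _⊆_)

import Algebra.Properties.CommutativeMonoid.Sum ℕ.+-0-commutativeMonoid as ℕ-Sum
import Algebra.Properties.CommutativeMonoid.Sum Sign.*-commutativeMonoid as Sign-Product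

private variable
  m n : ℕ

------------------------------------------------------------------------
-- Length, reflections and weak order for a group with chosen generators

module WeakOrder (G : Group 0ℓ 0ℓ) {I : Set} (gen : I → Group.Carrier G) where
  open Group G

  word : List I → Carrier
  word = foldr (λ i x → gen i ∙ x) ε

  -- Lengths are given by their graph: `x HasLength k` says ℓ(x) = k.
  _HasLength_ : Carrier → ℕ → Set
  x HasLength k = (∃ λ is → word is ≈ x × length is ≡ k)
                × (∀ is → word is ≈ x → k ℕ.≤ length is)

  -- ℓ(x) < ℓ(y)
  _ℓ<_ : Carrier → Carrier → Set
  x ℓ< y = ∃₂ λ k l → x HasLength k × y HasLength l × k ℕ.< l

  IsReflection : Pred Carrier 0ℓ
  IsReflection t = ∃₂ λ x i → t ≈ x ∙ gen i ∙ x ⁻¹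

  T_L : Carrier → Pred Carrier 0ℓ
  T_L w t = IsReflection t × (t ∙ w) ℓ< w

  infix 4 _≤ᴿ_
  _≤ᴿ_ : Carrier → Carrier → Set
  u ≤ᴿ w = T_L u ⊆ T_L w

  IsJoin : Carrier → Carrier → Carrier → Set
  IsJoin u w j = u ≤ᴿ j × w ≤ᴿ j × (∀ z → u ≤ᴿ z → w ≤ᴿ z → j ≤ᴿ z)

------------------------------------------------------------------------
-- The set ±[n] and signed permutations of it

-- `(s , i)` stands for the nonzero integer with sign `s` and absolute
-- value `suc (toℕ i)`; so 1, …, n are the elements
-- (+ , zero), (+ , suc zero), … .
±[_] : ℕ → Set
±[ n ] = Sign × Fin n

toℤ : ±[ n ] → ℤ
toℤ (s , i) = s ◃ suc (toℕ i)

infix 4 _≤±_ _<±_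
_≤±_ _<±_ : ±[ n ] → ±[ n ] → Set
x ≤± y = toℤ x ℤ.≤ toℤ y
x <± y = toℤ x ℤ.< toℤ y

neg : ±[ n ] → ±[ n ]
neg (s , i) = opposite s , i

infixr 7 _·_
_·_ : Sign → ±[ n ] → ±[ n ]
s · (t , i) = s Sign.* t , i

-- the inclusion ±[n] ⊆ ±[n+1]
incl : ±[ n ] → ±[ suc n ]
incl (s , i) = s , inject₁ i

-- the element n+1 of ±[n+1]
top : ±[ suc n ]
top = Sign.+ , fromℕ _

record SignedPerm (n : ℕ) : Set where
  field
    perm : ±[ n ] ↔ ±[ n ]
  open Inverse perm public using (to; from; strictlyInverseˡ; strictlyInverseʳ)
  field
    odd  : ∀ x → to (neg x) ≡ neg (to x)

  window : Vector ±[ n ] n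
  window i = to (Sign.+ , i)

ind : Sign → ℕ
ind Sign.- = 1
ind Sign.+ = 0

#negatives : Vector ±[ m ] n → ℕ
#negatives v = ℕ-Sum.sum (ind ∘ proj₁ ∘ v)

Even : SignedPerm n → Set
Even w = 2 ∣ #negatives (SignedPerm.window w)

record SD (n : ℕ) : Set where
  constructor _even:_
  field
    signedPerm : SignedPerm n
    even       : Even signedPerm
  open SignedPerm signedPerm public

------------------------------------------------------------------------
-- Auxiliary facts about signs

neg-involutive : (x : ±[ n ]) → neg (neg x) ≡ x
neg-involutive (Sign.- , i) = refl
neg-involutive (Sign.+ , i) = refl

·-neg : ∀ s (x : ±[ n ]) → opposite s · x ≡ neg (s · x)
·-neg Sign.- x = sym (neg-involutive x)
·-neg Sign.+ x = refl

cancel : ∀ s t → s Sign.* t Sign.* t ≡ s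
cancel s t = begin
  s Sign.* t Sign.* t   ≡⟨ Sign.*-assoc s t t ⟩
  s Sign.* (t Sign.* t) ≡⟨ cong (s Sign.*_) (Sign.s*s≡+ t) ⟩
  s Sign.* Sign.+       ≡⟨ Sign.*-identityʳ s ⟩
  s                     ∎
  where open ≡-Reasoning

module _ (w : SignedPerm n) where
  open SignedPerm w

  ·-to : ∀ s i → s · window i ≡ to (s , i)
  ·-to Sign.+ i = refl
  ·-to Sign.- i = sym (odd (Sign.+ , i))

  from-odd : ∀ x → from (neg x) ≡ neg (from x)
  from-odd x = begin
    from (neg x)              ≡⟨ cong (from ∘ neg) (strictlyInverseˡ x) ⟨
    from (neg (to (from x)))  ≡⟨ cong from (odd (from x)) ⟨
    from (to (neg (from x)))  ≡⟨ strictlyInverseʳ _ ⟩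
    neg (from x)              ∎
    where open ≡-Reasoning

------------------------------------------------------------------------
-- The product of the signs in the window, used to check evenness

signProduct : SignedPerm n → Sign
signProduct w = Sign-Product.sum (proj₁ ∘ SignedPerm.window w)

private
  parity : ℕ → Sign
  parity zero    = Sign.+
  parity (suc k) = opposite (parity k)

  parity-sum : (f : Vector Sign n) → parity (ℕ-Sum.sum (ind ∘ f)) ≡ Sign-Product.sum f
  parity-sum {zero}  f = refl
  parity-sum {suc n} f with f zero | parity-sum (f ∘ suc)
  ... | Sign.- | eq = cong opposite eq
  ... | Sign.+ | eq = eq

  parity-even : ∀ k → 2 ∣ k → parity k ≡ Sign.+
  parity-even _ (divides q refl) = go q
    where
    go : ∀ q → parity (q ℕ.* 2) ≡ Sign.+
    go zero    = refl
    go (suc q) = cong (opposite ∘ opposite) (go q)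

  even-parity : ∀ k → parity k ≡ Sign.+ → 2 ∣ k
  even-parity zero          _  = 2 ∣0
  even-parity (suc zero)    ()
  even-parity (suc (suc k)) eq = ∣m∣n⇒∣m+n ∣-refl (even-parity k
    (trans (sym (Sign.opposite-involutive _)) eq))

even⇒+ : (w : SignedPerm n) → Even w → signProduct w ≡ Sign.+
even⇒+ w e = trans (sym (parity-sum (proj₁ ∘ SignedPerm.window w))) (parity-even _ e)

+⇒even : (w : SignedPerm n) → signProduct w ≡ Sign.+ → Even w
+⇒even w e = even-parity _ (trans (parity-sum (proj₁ ∘ SignedPerm.window w)) e)

------------------------------------------------------------------------
-- The group of even signed permutations

idˢ : SignedPerm n
idˢ = record { perm = ↔-id _ ; odd = λ _ → refl }

_∘ˢ_ : SignedPerm n → SignedPerm n → SignedPerm n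
u ∘ˢ w = record
  { perm = U.perm ↔-∘ W.perm
  ; odd  = λ x → trans (cong U.to (W.odd x)) (U.odd (W.to x))
  }
  where
  module U = SignedPerm u
  module W = SignedPerm w

_⁻¹ˢ : SignedPerm n → SignedPerm n
w ⁻¹ˢ = record { perm = ↔-sym (SignedPerm.perm w) ; odd = from-odd w }

abs : SignedPerm n → Permutation′ n
abs w = permutation (λ i → proj₂ (to (Sign.+ , i))) (λ i → proj₂ (from (Sign.+ , i)))
  (λ i → lemma (w ⁻¹ˢ) i) (λ i → lemma w i)
  where
  open SignedPerm w
  lemma : ∀ (v : SignedPerm _) i →
          proj₂ (SignedPerm.from v (Sign.+ , proj₂ (SignedPerm.to v (Sign.+ , i)))) ≡ i
  lemma v i = begin
    proj₂ (V.from (Sign.+ , proj₂ x))             ≡⟨⟩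
    proj₂ (proj₁ x · V.from (Sign.+ , proj₂ x))   ≡⟨ cong proj₂ (·-to (v ⁻¹ˢ) (proj₁ x) (proj₂ x)) ⟩
    proj₂ (V.from x)                              ≡⟨ cong proj₂ (V.strictlyInverseʳ _) ⟩
    i                                             ∎
    where
    module V = SignedPerm v
    x = V.to (Sign.+ , i)
    open ≡-Reasoning

signProduct-id : ∀ n → signProduct (idˢ {n}) ≡ Sign.+
signProduct-id = Sign-Product.sum-replicate-zero

signProduct-∘ : (u w : SignedPerm n) →
                signProduct (u ∘ˢ w) ≡ signProduct w Sign.* signProduct u
signProduct-∘ u w = begin
  sum (λ i → proj₁ (U.to (W.window i)))
    ≡⟨ sum-cong-≗ (λ i → cong proj₁ (·-to u (proj₁ (W.window i)) (proj₂ (W.window i)))) ⟨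
  sum (λ i → proj₁ (W.window i) Sign.* proj₁ (U.window (abs w ⟨$⟩ʳ i)))
    ≡⟨ ∑-distrib-+ (proj₁ ∘ W.window) _ ⟩
  signProduct w Sign.* sum (λ i → proj₁ (U.window (abs w ⟨$⟩ʳ i)))
    ≡⟨ cong (signProduct w Sign.*_) (sum-permute (proj₁ ∘ U.window) (abs w)) ⟨
  signProduct w Sign.* signProduct u ∎
  where
  module U = SignedPerm u
  module W = SignedPerm w
  open Sign-Product
  open ≡-Reasoning

signProduct-cong : (u w : SignedPerm n) →
                   (∀ x → SignedPerm.to u x ≡ SignedPerm.to w x) →
                   signProduct u ≡ signProduct w
signProduct-cong u w eq = Sign-Product.sum-cong-≗ (λ i → cong proj₁ (eq (Sign.+ , i)))

signProduct-⁻¹ : (w : SignedPerm n) → signProduct w ≡ Sign.+ → signProduct (w ⁻¹ˢ) ≡ Sign.+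
signProduct-⁻¹ {n} w eq = begin
  signProduct (w ⁻¹ˢ)                       ≡⟨⟩
  Sign.+ Sign.* signProduct (w ⁻¹ˢ)         ≡⟨ cong (Sign._* signProduct (w ⁻¹ˢ)) eq ⟨
  signProduct w Sign.* signProduct (w ⁻¹ˢ)  ≡⟨ signProduct-∘ (w ⁻¹ˢ) w ⟨
  signProduct ((w ⁻¹ˢ) ∘ˢ w)                ≡⟨ signProduct-cong ((w ⁻¹ˢ) ∘ˢ w) idˢ (SignedPerm.strictlyInverseʳ w) ⟩
  signProduct (idˢ {n})                     ≡⟨ signProduct-id n ⟩
  Sign.+                                    ∎
  where open ≡-Reasoning

infix 4 _≈_
_≈_ : SD n → SD n → Set
u ≈ w = ∀ x → SD.to u x ≡ SD.to w x

SD-group : ℕ → Group 0ℓ 0ℓ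
SD-group n = record
  { Carrier = SD n
  ; _≈_     = _≈_
  ; _∙_     = λ (u even: e) (w even: f) → (u ∘ˢ w) even:
                +⇒even (u ∘ˢ w) (trans (signProduct-∘ u w) (cong₂ Sign._*_ (even⇒+ w f) (even⇒+ u e)))
  ; ε       = idˢ even: +⇒even (idˢ {n}) (signProduct-id n)
  ; _⁻¹     = λ (w even: e) → (w ⁻¹ˢ) even: +⇒even (w ⁻¹ˢ) (signProduct-⁻¹ w (even⇒+ w e))
  ; isGroup = record
    { isMonoid = record
      { isSemigroup = record
        { isMagma = record
          { isEquivalence = record
            { refl  = λ _ → refl
            ; sym   = λ p x → sym (p x)
            ; trans = λ p q x → trans (p x) (q x)
            }
          ; ∙-cong = λ {_} {u′} {w} p q x → trans (p (SD.to w x)) (cong (SD.to u′) (q x))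
          }
        ; assoc = λ _ _ _ _ → refl
        }
      ; identity = (λ _ _ → refl) , (λ _ _ → refl)
      }
    ; inverse = SD.strictlyInverseʳ , SD.strictlyInverseˡ
    ; ⁻¹-cong = λ {u} {w} p x → begin
        SD.from u x                          ≡⟨ cong (SD.from u) (SD.strictlyInverseˡ w x) ⟨
        SD.from u (SD.to w (SD.from w x))    ≡⟨ cong (SD.from u) (p (SD.from w x)) ⟨
        SD.from u (SD.to u (SD.from w x))    ≡⟨ SD.strictlyInverseʳ u _ ⟩
        SD.from w x                          ∎
    }
  }
  where open ≡-Reasoning

------------------------------------------------------------------------
-- The Coxeter generators

-- s₀ = (2̄ 1)(1̄ 2)
s₀ : SD (2 + n)
s₀ {n} = s even: +⇒even s (cong (opposite ∘ opposite) (signProduct-id n))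
  where
  f : ±[ 2 + n ] → ±[ 2 + n ]
  f (s , zero)        = opposite s , suc zero
  f (s , suc zero)    = opposite s , zero
  f (s , suc (suc i)) = s , suc (suc i)

  f-involutive : ∀ x → f (f x) ≡ x
  f-involutive (s , zero)        = neg-involutive (s , zero)
  f-involutive (s , suc zero)    = neg-involutive (s , suc zero)
  f-involutive (s , suc (suc i)) = refl

  f-odd : ∀ x → f (neg x) ≡ neg (f x)
  f-odd (s , zero)        = refl
  f-odd (s , suc zero)    = refl
  f-odd (s , suc (suc i)) = refl

  s : SignedPerm (2 + n)
  s = record { perm = mk↔ₛ′ f f f-involutive f-involutive ; odd = f-odd }

-- A permutation π of [n] as the signed permutation i ↦ π(i), ī ↦ π(i)̄.
unsigned : Permutation′ n → SD n
unsigned {n} π = s even: +⇒even s (signProduct-id n)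
  where
  s : SignedPerm n
  s = record
    { perm = mk↔ₛ′ (λ (s , i) → s , π ⟨$⟩ʳ i) (λ (s , i) → s , π ⟨$⟩ˡ i)
               (λ (s , i) → cong (s ,_) (inverseʳ π)) (λ (s , i) → cong (s ,_) (inverseˡ π))
    ; odd  = λ _ → refl
    }

-- The index of a generator is its index in s₀, s₁, …, sₙ₋₁. Since Fin
-- counts from 0, sᵢ exchanges the i-th and (i+1)-st of 1, …, n.
gen : Fin (2 + n) → SD (2 + n)
gen zero    = s₀
gen (suc i) = unsigned (transpose (inject₁ i) (suc i))

open module Weak {n : ℕ} = WeakOrder (SD-group (2 + n)) gen public

------------------------------------------------------------------------
-- Inserting the value ±(n+1) in a window

act : Vector ±[ n ] n → ±[ n ] → ±[ n ]
act v (s , i) = s · v i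

insert : SignedPerm n → ±[ suc n ] → SignedPerm (suc n)
insert {n} w (σ , q) = record
  { perm = mk↔ₛ′ (act v) g act-g g-act
  ; odd  = λ (s , i) → ·-neg s (v i)
  }
  where
  open SignedPerm w
  open ≡-Reasoning

  v : Vector ±[ suc n ] (suc n)
  v = insertAt (map incl window) q (σ , fromℕ n)

  punch : ±[ n ] → ±[ suc n ]
  punch (s , i) = s , punchIn q i

  g′ : Sign → {k : Fin (suc n)} → View k → ±[ suc n ]
  g′ s ‵fromℕ           = s Sign.* σ , q
  g′ s (‵inj₁ {i = i} _) = punch (from (s , i))

  g : ±[ suc n ] → ±[ suc n ]
  g (s , k) = g′ s (view k)

  g-top : ∀ s → g (s , fromℕ n) ≡ (s Sign.* σ , q)
  g-top s rewrite view-fromℕ n = refl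

  g-incl : ∀ x → g (incl x) ≡ punch (from x)
  g-incl (s , i) rewrite view-inject₁ i = refl

  act-q : ∀ s → act v (s , q) ≡ (s Sign.* σ , fromℕ n)
  act-q s = cong (s ·_) (insertAt-lookup (map incl window) q _)

  act-punch : ∀ x → act v (punch x) ≡ incl (to x)
  act-punch (s , i) = trans (cong (s ·_) (insertAt-punchIn (map incl window) q _ i))
                            (cong incl (·-to w s i))

  act-g : ∀ x → act v (g x) ≡ x
  act-g (s , k) with view k
  ... | ‵fromℕ          = trans (act-q (s Sign.* σ)) (cong (_, fromℕ n) (cancel s σ))
  ... | ‵inj₁ {i = i} _ = trans (act-punch (from (s , i))) (cong incl (strictlyInverseˡ (s , i)))

  g-act : ∀ x → g (act v x) ≡ x
  g-act (s , i) with q ≟ i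
  ... | yes refl = begin
    g (act v (s , q))           ≡⟨ cong g (act-q s) ⟩
    g (s Sign.* σ , fromℕ n)    ≡⟨ g-top _ ⟩
    (s Sign.* σ Sign.* σ , q)   ≡⟨ cong (_, q) (cancel s σ) ⟩
    (s , q)                     ∎
  ... | no q≢i = begin
    g (act v (s , i))           ≡⟨ cong (λ k → g (act v (s , k))) (punchIn-punchOut q≢i) ⟨
    g (act v (punch x))         ≡⟨ cong g (act-punch x) ⟩
    g (incl (to x))             ≡⟨ g-incl (to x) ⟩
    punch (from (to x))         ≡⟨ cong punch (strictlyInverseʳ x) ⟩
    punch x                     ≡⟨ cong (s ,_) (punchIn-punchOut q≢i) ⟩
    (s , i)                     ∎
    where x = s , punchOut q≢i

signProduct-insert : (w : SignedPerm n) (x : ±[ suc n ]) →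
                     signProduct (insert w x) ≡ proj₁ x Sign.* signProduct w
signProduct-insert w (σ , q) = trans
  (Sign-Product.sum-remove {i = q} (proj₁ ∘ SignedPerm.window (insert w (σ , q))))
  (cong₂ Sign._*_
    (cong proj₁ (insertAt-lookup (map incl (SignedPerm.window w)) q _))
    (Sign-Product.sum-cong-≗ (λ i → cong proj₁ (insertAt-punchIn (map incl (SignedPerm.window w)) q _ i))))

flipFirst : SignedPerm (suc n) → SignedPerm (suc n)
flipFirst {n} w = record
  { perm = mk↔ₛ′ (act v) (f ∘ from)
      (λ x → trans (act-f (f (from x))) (trans (cong to (f-involutive (from x))) (strictlyInverseˡ x)))
      (λ x → trans (cong (f ∘ from) (act-f x)) (trans (cong f (strictlyInverseʳ (f x))) (f-involutive x)))
  ; odd  = λ (s , i) → ·-neg s (v i)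
  }
  where
  open SignedPerm w

  v : Vector ±[ suc n ] (suc n)
  v = updateAt window zero neg

  f : ±[ suc n ] → ±[ suc n ]
  f (s , zero)  = opposite s , zero
  f (s , suc i) = s , suc i

  f-involutive : ∀ x → f (f x) ≡ x
  f-involutive (s , zero)  = neg-involutive (s , zero)
  f-involutive (s , suc i) = refl

  act-f : ∀ x → act v x ≡ to (f x)
  act-f (Sign.- , zero)  = neg-involutive (window zero)
  act-f (Sign.+ , zero)  = sym (odd (Sign.+ , zero))
  act-f (s      , suc i) = ·-to w s (suc i)

signProduct-flipFirst : (w : SignedPerm (suc n)) →
                        signProduct (flipFirst w) ≡ opposite (signProduct w)
signProduct-flipFirst w with proj₁ (SignedPerm.window w zero)
... | Sign.- = sym (Sign.opposite-involutive _)
... | Sign.+ = refl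

-- j′ ^⟨ p ⟩ is j⁽ᵖ⁾; the sign of p is the sign of the
-- inserted entry and ∣p∣ its position.
_^⟨_⟩ : SD (suc n) → ±[ 2 + n ] → SD (2 + n)
(w even: e) ^⟨ Sign.+ , q ⟩ = v even: +⇒even v (trans (signProduct-insert w (Sign.+ , q)) (even⇒+ w e))
  where v = insert w (Sign.+ , q)
(w even: e) ^⟨ Sign.- , q ⟩ = v even: +⇒even v (begin
  signProduct v                          ≡⟨ signProduct-insert (flipFirst w) (Sign.- , q) ⟩
  opposite (signProduct (flipFirst w))   ≡⟨ cong opposite (signProduct-flipFirst w) ⟩
  opposite (opposite (signProduct w))    ≡⟨ cong (opposite ∘ opposite) (even⇒+ w e) ⟩
  Sign.+                                 ∎)
  where
  v = insert (flipFirst w) (Sign.- , q)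
  open ≡-Reasoning

^-window⁺ : (w : SD (suc n)) (q : Fin (2 + n)) →
            SD.window (w ^⟨ Sign.+ , q ⟩)
              ≡ insertAt (map incl (SD.window w)) q (Sign.+ , fromℕ _)
^-window⁺ w q = refl

^-window⁻ : (w : SD (suc n)) (q : Fin (2 + n)) →
            SD.window (w ^⟨ Sign.- , q ⟩)
              ≡ insertAt (map incl (updateAt (SD.window w) zero neg)) q (Sign.- , fromℕ _)
^-window⁻ w q = refl

------------------------------------------------------------------------
-- The standard parabolic subgroup and the parabolic projection

-- the inclusion of S^D_n in S^D_{n+1} as the elements fixing n+1
embed : SD (suc n) → SD (2 + n)
embed w = w ^⟨ top ⟩

IsParabolicProjection : SD (3 + n) → SD (2 + n) → Set
IsParabolicProjection {n} w w′ = ∃ λ v →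
  w ≈ embed w′ ∙ v × (∀ (i : Fin (2 + n)) → v ℓ< (gen (inject₁ i) ∙ v))
  where open Group (SD-group (3 + n)) using (_∙_)

------------------------------------------------------------------------
-- The condition on j⁽ᵖ⁾

-- k occurs to the right of n+1 in the complete notation of w
_RightOfTopIn_ : ±[ n ] → SD (suc n) → Set
k RightOfTopIn w = SD.from w top <± SD.from w (incl k)

Admissible : (u w j : SD (suc n)) → Set
Admissible {n} u w j =
  ∀ (k : ±[ n ]) → k RightOfTopIn u ⊎ k RightOfTopIn w → k RightOfTopIn j

IsLargest : Pred ±[ n ] 0ℓ → Pred ±[ n ] 0ℓ
IsLargest P p = P p × (∀ q → P q → q ≤± p)

{-# OPTIONS --safe #-}

-- For t the reflection exchanging the values a < b (∣ a ∣ ≠ ∣ b ∣), ℓ (t w) < ℓ (w) holds iff b stands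
-- before a in the complete notation of w, i.e. iff (a , b) is an inversion of w. Hence the weak order
-- is inclusion of inversions. The inversions of z ∈ S^D_n are those of its restriction z′ to ±[n-1]
-- together with, up to negation, the pairs (k , n) with k to the right of n. So an upper bound z of
-- u and w is one with j′ ≤ z′ in which every k right of n in u or w is right of n.
--
-- It remains to see that everything right of n in j⁽ᵖ⁾ is right of n in z. As p is largest, the entry x
-- of j′ just above n is right of n in u, say. If y comes after x in j′ and x < y, then x precedes y in u,
-- so y is right of n in u; if y < x, then (y , x) is an inversion of j′, so x precedes y in z. The
-- remaining value y = −x is reached through the first entry of j′ and its negative.

module Submission where

open import Defs
open import Algebra.Bundles using (Group)
open import Data.Empty using (⊥)
open import Data.Fin.Base using (Fin; zero; suc; inject₁; fromℕ; toℕ; punchIn)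
open import Data.Fin.Induction using (<-weakInduction; >-weakInduction)
import Data.Fin.Permutation.Components as Components
open import Data.Fin.Properties as Fin using (toℕ-injective; toℕ-inject₁)
open import Data.Fin.Relation.Unary.Top using (view; ‵fromℕ; ‵inj₁; view-fromℕ; view-inject₁)
open import Data.Integer.Base as ℤ using (-<-; -<+; +<+; -≤-; -≤+; +≤+)
import Data.Integer.Properties as ℤ
open import Data.List.Base using (List; []; _∷_; _++_; length; map)
open import Data.Nat.Base as ℕ using (ℕ; zero; suc; _+_; z≤n; s≤s; s<s)
import Data.Nat.Properties as ℕ
open import Data.Product.Base using (_×_; _,_; ∃; proj₁; proj₂)
open import Data.Product.Properties using (≡-dec)
open import Data.Sign.Base as Sign using (Sign; opposite)
import Data.Sign.Properties as Sign
open import Data.Sum.Base using (_⊎_; inj₁; inj₂; [_,_]′)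
open import Data.Unit.Base using (⊤; tt)
open import Function.Base using (_∘_; id)
open import Function.Bundles using (mk↔ₛ′)
open import Relation.Binary.Definitions using (tri<; tri≈; tri>)
open import Relation.Binary.PropositionalEquality
open import Relation.Nullary using (¬_; Dec; yes; no; contradiction)
open import Relation.Nullary.Decidable using (map′; _×-dec_; _⊎-dec_; _→-dec_)

private variable
  m n : ℕ

-- The ordered set ±[n]

∣_∣ : ±[ n ] → Fin n
∣_∣ = proj₂

toℤ-abs : {a b : ±[ n ]} → toℤ a ≡ toℤ b → ∣ a ∣ ≡ ∣ b ∣
toℤ-abs {a = s , i} {t , j} eq = toℕ-injective (ℕ.suc-injective (begin
  suc (toℕ i)                    ≡⟨ ℤ.abs-◃ s (suc (toℕ i)) ⟨
  ℤ.∣ s ℤ.◃ suc (toℕ i) ∣        ≡⟨ cong ℤ.∣_∣ eq ⟩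
  ℤ.∣ t ℤ.◃ suc (toℕ j) ∣        ≡⟨ ℤ.abs-◃ t (suc (toℕ j)) ⟩
  suc (toℕ j)                    ∎))
  where open ≡-Reasoning

<±-connex : (a b : ±[ n ]) → ∣ a ∣ ≢ ∣ b ∣ → a <± b ⊎ b <± a
<±-connex a b a≁b with ℤ.<-cmp (toℤ a) (toℤ b)
... | tri< a<b _ _ = inj₁ a<b
... | tri≈ _ eq _  = contradiction (toℤ-abs {a = a} {b} eq) a≁b
... | tri> _ _ b<a = inj₂ b<a

<±-trans : (a b c : ±[ n ]) → a <± b → b <± c → a <± c
<±-trans a b c = ℤ.<-trans {toℤ a} {toℤ b} {toℤ c}

<±-asym : (a b : ±[ n ]) → a <± b → ¬ b <± a
<±-asym a b = ℤ.<-asym {toℤ a} {toℤ b}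

neg-anti : (a b : ±[ n ]) → a <± b → neg b <± neg a
neg-anti (Sign.- , i) (Sign.- , j) (-<- p)       = +<+ (s<s p)
neg-anti (Sign.- , i) (Sign.+ , j) -<+           = -<+
neg-anti (Sign.+ , i) (Sign.+ , j) (+<+ (s≤s p)) = -<- p

neg-cancel : (a b : ±[ n ]) → neg b <± neg a → a <± b
neg-cancel a b p = subst₂ _<±_ (neg-involutive a) (neg-involutive b) (neg-anti (neg b) (neg a) p)

same-abs : (a b : ±[ n ]) → ∣ a ∣ ≡ ∣ b ∣ → a ≡ b ⊎ a ≡ neg b
same-abs (Sign.- , i) (Sign.- , .i) refl = inj₁ refl
same-abs (Sign.- , i) (Sign.+ , .i) refl = inj₂ refl
same-abs (Sign.+ , i) (Sign.- , .i) refl = inj₂ refl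
same-abs (Sign.+ , i) (Sign.+ , .i) refl = inj₁ refl

all±? : {P : ±[ n ] → Set} → (∀ x → Dec (P x)) → Dec (∀ x → P x)
all±? P? = map′ (λ (p , q) → λ { (Sign.+ , i) → p i ; (Sign.- , i) → q i })
                (λ h → (λ i → h (Sign.+ , i)) , λ i → h (Sign.- , i))
                (Fin.all? (λ i → P? (Sign.+ , i)) ×-dec Fin.all? (λ i → P? (Sign.- , i)))

-- Even signed permutations

open module SDGroup {n : ℕ} = Group (SD-group n) using (_∙_; ε; _⁻¹)

to-abs : (w : SD n) (a b : ±[ n ]) → ∣ a ∣ ≡ ∣ b ∣ → ∣ SD.to w a ∣ ≡ ∣ SD.to w b ∣
to-abs w a b eq with same-abs a b eq
... | inj₁ refl = refl
... | inj₂ refl = cong ∣_∣ (SD.odd w b)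

from-abs : (w : SD n) (a b : ±[ n ]) → ∣ a ∣ ≡ ∣ b ∣ → ∣ SD.from w a ∣ ≡ ∣ SD.from w b ∣
from-abs w = to-abs (w ⁻¹)

to-abs⁻ : (w : SD n) (a b : ±[ n ]) → ∣ SD.to w a ∣ ≡ ∣ SD.to w b ∣ → ∣ a ∣ ≡ ∣ b ∣
to-abs⁻ w a b eq = subst₂ (λ x y → ∣ x ∣ ≡ ∣ y ∣) (SD.strictlyInverseʳ w a) (SD.strictlyInverseʳ w b)
  (from-abs w _ _ eq)

from-abs⁻ : (w : SD n) (a b : ±[ n ]) → ∣ SD.from w a ∣ ≡ ∣ SD.from w b ∣ → ∣ a ∣ ≡ ∣ b ∣
from-abs⁻ w = to-abs⁻ (w ⁻¹)

to⇒from : (u : SD n) {x y : ±[ n ]} → SD.to u x ≡ y → SD.from u y ≡ x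
to⇒from u eq = trans (cong (SD.from u) (sym eq)) (SD.strictlyInverseʳ u _)

from⇒to : (u : SD n) {x y : ±[ n ]} → SD.from u x ≡ y → SD.to u y ≡ x
from⇒to u = to⇒from (u ⁻¹)

from-cong : {u w : SD n} → u ≈ w → ∀ x → SD.from u x ≡ SD.from w x
from-cong {u = u} {w} = SDGroup.⁻¹-cong {x = u} {w}

-- Inversions and the reflections exchanging two values

-- The pairs (a, b) and (-b, -a) describe the same reflection. Pairs with equal absolute values are
-- allowed here although no reflection of type D exchanges k and -k, so statements about reflections
-- carry `∣ a ∣ ≢ ∣ b ∣` as well.
record Inv (w : SD n) (a b : ±[ n ]) : Set where
  constructor inv
  field
    less     : a <± b
    inverted : SD.from w b <± SD.from w a

Inv-neg : (w : SD n) {a b : ±[ n ]} → Inv w a b → Inv w (neg b) (neg a)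
Inv-neg w {a} {b} (inv l i) = inv (neg-anti a b l)
  (subst₂ _<±_ (sym (from-odd (SD.signedPerm w) a)) (sym (from-odd (SD.signedPerm w) b)) (neg-anti _ _ i))

Inv-neg⁻ : (w : SD n) {a b : ±[ n ]} → Inv w (neg b) (neg a) → Inv w a b
Inv-neg⁻ w {a} {b} h = subst₂ (Inv w) (neg-involutive a) (neg-involutive b) (Inv-neg w h)

Inv-cong : {u w : SD n} → u ≈ w → ∀ {a b} → Inv u a b → Inv w a b
Inv-cong {u = u} {w} eq {a} {b} (inv l i) =
  inv l (subst₂ _<±_ (from-cong {u = u} {w} eq b) (from-cong {u = u} {w} eq a) i)

-- Reflections are handled through their effect on values. The images of -a and -b are forced by
-- oddness, so the three fields determine `t` completely.
record IsSwap (t : SD n) (a b : ±[ n ]) : Set where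
  constructor swap
  field
    at-a  : SD.to t a ≡ b
    at-b  : SD.to t b ≡ a
    fixes : ∀ x → ∣ x ∣ ≢ ∣ a ∣ → ∣ x ∣ ≢ ∣ b ∣ → SD.to t x ≡ x

IsSwap-sym : {t : SD n} {a b : ±[ n ]} → IsSwap t a b → IsSwap t b a
IsSwap-sym (swap p q f) = swap q p (λ x x≁b x≁a → f x x≁a x≁b)

IsSwap-neg : {t : SD n} {a b : ±[ n ]} → IsSwap t a b → IsSwap t (neg a) (neg b)
IsSwap-neg {t = t} {a} {b} (swap p q f) =
  swap (trans (SD.odd t a) (cong neg p)) (trans (SD.odd t b) (cong neg q)) f

IsSwap-unique : {t t′ : SD n} {a b : ±[ n ]} → IsSwap t a b → IsSwap t′ a b → t ≈ t′
IsSwap-unique {t = t} {t′} {a} {b} h h′ x with ∣ x ∣ Fin.≟ ∣ a ∣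
... | yes x~a with same-abs x a x~a
...   | inj₁ refl = trans (IsSwap.at-a h) (sym (IsSwap.at-a h′))
...   | inj₂ refl = trans (IsSwap.at-a (IsSwap-neg h)) (sym (IsSwap.at-a (IsSwap-neg h′)))
IsSwap-unique {t = t} {t′} {a} {b} h h′ x | no x≁a with ∣ x ∣ Fin.≟ ∣ b ∣
... | no x≁b = trans (IsSwap.fixes h x x≁a x≁b) (sym (IsSwap.fixes h′ x x≁a x≁b))
... | yes x~b with same-abs x b x~b
...   | inj₁ refl = trans (IsSwap.at-b h) (sym (IsSwap.at-b h′))
...   | inj₂ refl = trans (IsSwap.at-b (IsSwap-neg h)) (sym (IsSwap.at-b (IsSwap-neg h′)))

-- The inverse of `t` exchanges a and b too, so by uniqueness it coincides with `t`.
IsSwap-involutive : {t : SD n} {a b : ±[ n ]} → IsSwap t a b → ∀ x → SD.to t (SD.to t x) ≡ x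
IsSwap-involutive {t = t} {a} {b} h x =
  trans (cong (SD.to t) (IsSwap-unique h inverse x)) (SD.strictlyInverseˡ t x)
  where
  inverse : IsSwap (t ⁻¹) a b
  inverse = swap (to⇒from t (IsSwap.at-b h)) (to⇒from t (IsSwap.at-a h))
                 (λ x p q → to⇒from t (IsSwap.fixes h x p q))

IsSwap-from : {t : SD n} {a b : ±[ n ]} → IsSwap t a b → ∀ x → SD.from t x ≡ SD.to t x
IsSwap-from {t = t} h x = to⇒from t (IsSwap-involutive h x)

IsSwap-conj : (x t : SD n) {t′ : SD n} {a b a′ b′ : ±[ n ]} → t′ ≈ x ∙ t ∙ x ⁻¹ →
              SD.to x a ≡ a′ → SD.to x b ≡ b′ → IsSwap t a b → IsSwap t′ a′ b′
IsSwap-conj x t {t′} {a} {b} t′≈ refl refl (swap p q f) = swap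
  (trans (t′≈ _) (cong (SD.to x) (trans (cong (SD.to t) (SD.strictlyInverseʳ x a)) p)))
  (trans (t′≈ _) (cong (SD.to x) (trans (cong (SD.to t) (SD.strictlyInverseʳ x b)) q)))
  (λ y y≁a y≁b → trans (t′≈ y) (trans
    (cong (SD.to x) (f (SD.from x y) (away y a y≁a) (away y b y≁b)))
    (SD.strictlyInverseˡ x y)))
  where
  away : ∀ y c → ∣ y ∣ ≢ ∣ SD.to x c ∣ → ∣ SD.from x y ∣ ≢ ∣ c ∣
  away y c y≁ eq = y≁ (trans (cong ∣_∣ (sym (SD.strictlyInverseˡ x y))) (to-abs x _ c eq))

-- The generators

transpose-cases : (i j k : Fin n) →
  (k ≡ i × Components.transpose i j k ≡ j) ⊎
  (k ≡ j × Components.transpose i j k ≡ i) ⊎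
  (k ≢ i × k ≢ j × Components.transpose i j k ≡ k)
transpose-cases i j k with k Fin.≟ i
... | yes p = inj₁ (p , refl)
... | no ¬p with k Fin.≟ j
...   | yes q = inj₂ (inj₁ (q , refl))
...   | no ¬q = inj₂ (inj₂ (¬p , ¬q , refl))

-- A uniform description of the generators: s₀ exchanges -1 < 2 and sᵢ exchanges i < i+1, so s₀
-- rarely has to be treated separately.
lower upper : Fin (2 + n) → ±[ 2 + n ]
lower zero    = Sign.- , zero
lower (suc i) = Sign.+ , inject₁ i
upper zero    = Sign.+ , suc zero
upper (suc i) = Sign.+ , suc i

inject₁<suc : (i : Fin n) → toℕ (inject₁ i) ℕ.< toℕ (suc i)
inject₁<suc i = s≤s (ℕ.≤-reflexive (toℕ-inject₁ i))

inject₁≢suc : (i : Fin n) → inject₁ i ≢ suc i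
inject₁≢suc i eq = ℕ.<-irrefl (cong toℕ eq) (inject₁<suc i)

lower≁upper : (i : Fin (2 + n)) → ∣ lower i ∣ ≢ ∣ upper i ∣
lower≁upper zero    ()
lower≁upper (suc i) = inject₁≢suc i

lower<upper : (i : Fin (2 + n)) → lower i <± upper i
lower<upper zero    = -<+
lower<upper (suc i) = +<+ (s<s (inject₁<suc i))

gen-swap : (i : Fin (2 + n)) → IsSwap (gen i) (lower i) (upper i)
gen-swap zero = swap refl refl fixes
  where
  fixes : ∀ x → ∣ x ∣ ≢ zero → ∣ x ∣ ≢ suc zero → SD.to (gen zero) x ≡ x
  fixes (s , zero)        x≁0 _   = contradiction refl x≁0
  fixes (s , suc zero)    _   x≁1 = contradiction refl x≁1
  fixes (s , suc (suc i)) _   _   = refl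
gen-swap (suc i) = swap at-a at-b fixes
  where
  at-a : SD.to (gen (suc i)) (lower (suc i)) ≡ upper (suc i)
  at-a with transpose-cases (inject₁ i) (suc i) (inject₁ i)
  ... | inj₁ (_ , eq)            = cong (Sign.+ ,_) eq
  ... | inj₂ (inj₁ (p , _))      = contradiction p (inject₁≢suc i)
  ... | inj₂ (inj₂ (p , _ , _))  = contradiction refl p
  at-b : SD.to (gen (suc i)) (upper (suc i)) ≡ lower (suc i)
  at-b with transpose-cases (inject₁ i) (suc i) (suc i)
  ... | inj₁ (p , _)             = contradiction (sym p) (inject₁≢suc i)
  ... | inj₂ (inj₁ (_ , eq))     = cong (Sign.+ ,_) eq
  ... | inj₂ (inj₂ (_ , p , _))  = contradiction refl p
  fixes : ∀ x → ∣ x ∣ ≢ inject₁ i → ∣ x ∣ ≢ suc i → SD.to (gen (suc i)) x ≡ x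
  fixes (s , k) k≢ k≢′ with transpose-cases (inject₁ i) (suc i) k
  ... | inj₁ (p , _)             = contradiction p k≢
  ... | inj₂ (inj₁ (p , _))      = contradiction p k≢′
  ... | inj₂ (inj₂ (_ , _ , eq)) = cong (s ,_) eq

-- No number lies strictly between the two exchanged neighbours, so every other comparison keeps its
-- direction.
transpose-inversion : (i : Fin n) (a b : Fin (suc n)) → toℕ a ℕ.< toℕ b →
  toℕ (Components.transpose (inject₁ i) (suc i) b) ℕ.< toℕ (Components.transpose (inject₁ i) (suc i) a) →
  a ≡ inject₁ i × b ≡ suc i
transpose-inversion i a b a<b τb<τa
  with transpose-cases (inject₁ i) (suc i) a | transpose-cases (inject₁ i) (suc i) b
... | inj₁ (p , _) | inj₂ (inj₁ (q , _)) = p , q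
... | inj₁ (refl , _) | inj₁ (refl , _) = contradiction a<b (ℕ.<-irrefl refl)
... | inj₁ (refl , eq) | inj₂ (inj₂ (_ , _ , eq′)) rewrite eq | eq′ | toℕ-inject₁ i =
  contradiction a<b (ℕ.<⇒≱ τb<τa)
... | inj₂ (inj₁ (refl , _)) | inj₁ (refl , _) = contradiction (inject₁<suc i) (ℕ.<-asym a<b)
... | inj₂ (inj₁ (refl , _)) | inj₂ (inj₁ (refl , _)) = contradiction a<b (ℕ.<-irrefl refl)
... | inj₂ (inj₁ (refl , eq)) | inj₂ (inj₂ (_ , _ , eq′)) rewrite eq | eq′ =
  contradiction (ℕ.<-trans τb<τa (inject₁<suc i)) (ℕ.<-asym a<b)
... | inj₂ (inj₂ (_ , _ , eq)) | inj₁ (refl , eq′) rewrite eq | eq′ =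
  contradiction (ℕ.<-trans (inject₁<suc i) τb<τa) (ℕ.<-asym a<b)
... | inj₂ (inj₂ (_ , _ , eq)) | inj₂ (inj₁ (refl , eq′)) rewrite eq | eq′ | toℕ-inject₁ i =
  contradiction a<b (ℕ.≤⇒≯ τb<τa)
... | inj₂ (inj₂ (_ , _ , eq)) | inj₂ (inj₂ (_ , _ , eq′)) rewrite eq | eq′ =
  contradiction τb<τa (ℕ.<-asym a<b)

-- A simple reflection reverses a single pair up to negation. Concluding with `IsSwap` covers both
-- (lower, upper) and (-upper, -lower).
gen-inversion : (i : Fin (2 + n)) (a b : ±[ 2 + n ]) → ∣ a ∣ ≢ ∣ b ∣ → a <± b →
                SD.to (gen i) b <± SD.to (gen i) a → IsSwap (gen i) a b
gen-inversion zero (s , zero) (t , zero) a≁b _ _ = contradiction refl a≁b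
gen-inversion zero (s , suc zero) (t , suc zero) a≁b _ _ = contradiction refl a≁b
gen-inversion zero (Sign.- , zero) (Sign.+ , suc zero) _ _ _ = gen-swap zero
gen-inversion zero (Sign.- , suc zero) (Sign.+ , zero) _ _ _ = IsSwap-sym (IsSwap-neg (gen-swap zero))
gen-inversion zero (Sign.- , zero) (Sign.- , suc zero) _ (-<- ()) _
gen-inversion zero (Sign.- , suc zero) (Sign.- , zero) _ _ (+<+ (s≤s ()))
gen-inversion zero (Sign.+ , zero) (Sign.+ , suc zero) _ _ (-<- ())
gen-inversion zero (Sign.+ , suc zero) (Sign.+ , zero) _ (+<+ (s≤s ())) _
gen-inversion zero (s , zero) (Sign.+ , suc (suc j)) _ _ p with s
... | Sign.- = contradiction p λ { (+<+ (s≤s (s≤s ()))) }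
... | Sign.+ = contradiction p λ ()
gen-inversion zero (s , zero) (Sign.- , suc (suc j)) _ p _ with s
... | Sign.- = contradiction p λ { (-<- ()) }
... | Sign.+ = contradiction p λ ()
gen-inversion zero (s , suc zero) (Sign.+ , suc (suc j)) _ _ p with s
... | Sign.- = contradiction p λ { (+<+ (s≤s ())) }
... | Sign.+ = contradiction p λ ()
gen-inversion zero (s , suc zero) (Sign.- , suc (suc j)) _ p _ with s
... | Sign.- = contradiction p λ { (-<- (s≤s ())) }
... | Sign.+ = contradiction p λ ()
gen-inversion zero (Sign.+ , suc (suc i)) (s , zero) _ p _ with s
... | Sign.- = contradiction p λ ()
... | Sign.+ = contradiction p λ { (+<+ (s≤s ())) }
gen-inversion zero (Sign.- , suc (suc i)) (s , zero) _ _ p with s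
... | Sign.- = contradiction p λ ()
... | Sign.+ = contradiction p λ { (-<- (s≤s ())) }
gen-inversion zero (Sign.+ , suc (suc i)) (s , suc zero) _ p _ with s
... | Sign.- = contradiction p λ ()
... | Sign.+ = contradiction p λ { (+<+ (s≤s (s≤s ()))) }
gen-inversion zero (Sign.- , suc (suc i)) (s , suc zero) _ _ p with s
... | Sign.- = contradiction p λ ()
... | Sign.+ = contradiction p λ { (-<- ()) }
gen-inversion zero a@(_ , suc (suc i)) b@(_ , suc (suc j)) _ p q = contradiction q (<±-asym a b p)
gen-inversion (suc i) (Sign.+ , a) (Sign.+ , b) _ (+<+ (s≤s p)) (+<+ (s≤s q))
  with refl , refl ← transpose-inversion i a b p q = gen-swap (suc i)
gen-inversion (suc i) (Sign.- , a) (Sign.- , b) _ (-<- p) (-<- q)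
  with refl , refl ← transpose-inversion i b a p q = IsSwap-sym (IsSwap-neg (gen-swap (suc i)))
gen-inversion (suc i) (Sign.- , a) (Sign.+ , b) _ _ ()
gen-inversion (suc i) (Sign.+ , a) (Sign.- , b) _ () _

gen-involutive : (i : Fin (2 + n)) (x : ±[ 2 + n ]) → SD.to (gen i) (SD.to (gen i) x) ≡ x
gen-involutive i = IsSwap-involutive (gen-swap i)

gen-from : (i : Fin (2 + n)) (x : ±[ 2 + n ]) → SD.from (gen i) x ≡ SD.to (gen i) x
gen-from i = IsSwap-from (gen-swap i)

-- The conclusion of the strong exchange condition, with one letter fewer. The reflection is
-- produced and not given: this is also how an inverted pair of values acquires the reflection that
-- exchanges it.
Exchange : List (Fin (2 + n)) → ±[ 2 + n ] → ±[ 2 + n ] → Set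
Exchange is a b = ∃ λ t → IsReflection t × IsSwap t a b ×
  ∃ λ is′ → word is′ ≈ t ∙ word is × length is ≡ suc (length is′)

-- With s the first letter and t the reflection found for the tail, (s t s) s `is` = s t `is`, so
-- the letter is deleted in the tail. Conjugation by the involution s turns the pair sa, sb back
-- into a, b.
exchange-deep : ∀ i (is : List (Fin (2 + n))) (a b : ±[ 2 + n ]) →
  Exchange is (SD.to (gen i) a) (SD.to (gen i) b) → Exchange (i ∷ is) a b
exchange-deep i is a b (t , (x , j , t≈) , t-swap , is′ , shorter , len) =
  gen i ∙ t ∙ gen i ⁻¹ ,
  (gen i ∙ x , j , λ y → cong (SD.to (gen i)) (t≈ _)) ,
  IsSwap-conj (gen i) t (λ _ → refl) (gen-involutive i a) (gen-involutive i b) t-swap ,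
  i ∷ is′ ,
  (λ y → cong (SD.to (gen i)) (trans (shorter y) (cong (SD.to t) (sym (SD.strictlyInverseʳ (gen i) _))))) ,
  cong suc len

-- If t exchanges the values a < b and they are inverted in the word s ∷ ws, then
-- either t = s, which can be deleted, or s t s exchanges two values inverted in ws.
exchange : (is : List (Fin (2 + n))) (a b : ±[ 2 + n ]) → ∣ a ∣ ≢ ∣ b ∣ → Inv (word is) a b → Exchange is a b
exchange []       a b a≁b (inv a<b b<a) = contradiction b<a (<±-asym a b a<b)
exchange (i ∷ is) a b a≁b (inv a<b b<a) =
  [ (λ sa<sb → exchange-deep i is a b (exchange is (SD.to (gen i) a) (SD.to (gen i) b) sa≁sb
      (inv sa<sb (subst₂ (λ x y → SD.from (word is) y <± SD.from (word is) x)
                         (gen-from i a) (gen-from i b) b<a))))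
  , (λ sb<sa → gen i , (ε , i , λ _ → refl) , gen-inversion i a b a≁b a<b sb<sa ,
               is , (λ x → sym (gen-involutive i _)) , refl)
  ]′ (<±-connex (SD.to (gen i) a) (SD.to (gen i) b) sa≁sb)
  where
  sa≁sb : ∣ SD.to (gen i) a ∣ ≢ ∣ SD.to (gen i) b ∣
  sa≁sb eq = a≁b (to-abs⁻ (gen i) a b eq)

-- Lengths

HasWord : SD (2 + n) → ℕ → Set
HasWord u k = ∃ λ is → word is ≈ u × length is ≡ k

_≈?_ : (u w : SD n) → Dec (u ≈ w)
u ≈? w = all±? λ x → ≡-dec Sign._≟_ Fin._≟_ (SD.to u x) (SD.to w x)

-- Search over the first letter: there are finitely many generators, and equality in the group is
-- decidable. This makes the length, defined as a minimum, available constructively.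
hasWord? : ∀ k (u : SD (2 + n)) → Dec (HasWord u k)
hasWord? zero u = map′ (λ eq → [] , eq , refl) (λ { ([] , eq , _) → eq }) (ε ≈? u)
hasWord? (suc k) u = map′
  (λ (i , is , eq , len) → i ∷ is ,
    (λ x → trans (cong (SD.to (gen i)) (eq x)) (SD.strictlyInverseˡ (gen i) _)) , cong suc len)
  (λ { (i ∷ is , eq , len) → i , is ,
    (λ x → trans (sym (SD.strictlyInverseʳ (gen i) _)) (cong (SD.from (gen i)) (eq x))) , ℕ.suc-injective len })
  (Fin.any? (λ i → hasWord? k (gen i ⁻¹ ∙ u)))

least : {P : ℕ → Set} → (∀ k → Dec (P k)) → ∀ n → P n → ∃ λ k → P k × (∀ j → P j → k ℕ.≤ j)
least {P} P? zero    Pn = zero , Pn , λ _ _ → z≤n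
least {P} P? (suc n) Pn with P? zero
... | yes P0 = zero , P0 , λ _ _ → z≤n
... | no ¬P0 with k , Pk , minimal ← least (P? ∘ suc) n Pn =
  suc k , Pk , λ { zero P0 → contradiction P0 ¬P0 ; (suc j) Pj → s≤s (minimal j Pj) }

hasLength : (u : SD (2 + n)) (is : List (Fin (2 + n))) → word is ≈ u → ∃ λ k → u HasLength k
hasLength u is eq =
  let k , w , minimal = least (λ k → hasWord? k u) (length is) (is , eq , refl)
  in  k , w , λ is′ eq′ → minimal (length is′) (is′ , eq′ , refl)

HasLength-cong : {u w : SD (2 + n)} {k : ℕ} → u ≈ w → u HasLength k → w HasLength k
HasLength-cong u≈w ((is , eq , len) , minimal) =
  (is , (λ x → trans (eq x) (u≈w x)) , len) , λ is′ eq′ → minimal is′ (λ x → trans (eq′ x) (sym (u≈w x)))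

-- Otherwise a and b are inverted in t u. Exchange on a word of length ℓ(t u) for t u would then
-- give a still shorter word for t (t u) = u, against ℓ(t u) < ℓ(u).
ℓ<⇒Inv : (u : SD (2 + n)) {t : SD (2 + n)} {a b : ±[ 2 + n ]} → ∣ a ∣ ≢ ∣ b ∣ → a <± b →
         IsSwap t a b → (t ∙ u) ℓ< u → Inv u a b
ℓ<⇒Inv {n} u {t} {a} {b} a≁b a<b t-swap (k , l , ((is , is≈ , len-is) , _) , (_ , minimal) , k<l) =
  [ (λ lt → contradiction k<l (ℕ.≤⇒≯ (l≤k lt))) , inv a<b ]′
    (<±-connex (SD.from u a) (SD.from u b) (a≁b ∘ from-abs⁻ u a b))
  where
  from-is : ∀ x → SD.from (word is) x ≡ SD.from u (SD.to t x)
  from-is x = trans (from-cong {u = word is} {t ∙ u} is≈ x) (cong (SD.from u) (IsSwap-from t-swap x))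

  back : {t′ : SD (2 + n)} {is′ : List (Fin (2 + n))} → IsSwap t′ a b → word is′ ≈ t′ ∙ word is → word is′ ≈ u
  back {t′} {is′} t′-swap is′≈ x = begin
    SD.to (word is′) x                   ≡⟨ is′≈ x ⟩
    SD.to t′ (SD.to (word is) x)         ≡⟨ cong (SD.to t′) (is≈ x) ⟩
    SD.to t′ (SD.to t (SD.to u x))       ≡⟨ IsSwap-unique t′-swap t-swap _ ⟩
    SD.to t (SD.to t (SD.to u x))        ≡⟨ IsSwap-involutive t-swap _ ⟩
    SD.to u x                            ∎
    where open ≡-Reasoning

  l≤k : SD.from u a <± SD.from u b → l ℕ.≤ k
  l≤k lt =
    let t′ , _ , t′-swap , is′ , is′≈ , len = exchange is a b a≁b (inv a<b (subst₂ _<±_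
          (sym (trans (from-is b) (cong (SD.from u) (IsSwap.at-b t-swap))))
          (sym (trans (from-is a) (cong (SD.from u) (IsSwap.at-a t-swap)))) lt))
    in ℕ.≤-trans (minimal is′ (back {t′} {is′} t′-swap is′≈))
         (ℕ.≤-trans (ℕ.n≤1+n _) (ℕ.≤-reflexive (trans (sym len) len-is)))

-- The generators generate

incl-mono : (a b : ±[ n ]) → a <± b → incl a <± incl b
incl-mono (Sign.- , i) (Sign.- , j) (-<- p) rewrite toℕ-inject₁ i | toℕ-inject₁ j = -<- p
incl-mono (Sign.- , i) (Sign.+ , j) -<+ = -<+
incl-mono (Sign.+ , i) (Sign.+ , j) (+<+ p) rewrite toℕ-inject₁ i | toℕ-inject₁ j = +<+ p

incl-injective : {a b : ±[ n ]} → incl a ≡ incl b → a ≡ b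
incl-injective eq = cong₂ _,_ (cong proj₁ eq) (Fin.inject₁-injective (cong ∣_∣ eq))

incl≁top : (x : ±[ n ]) → ∣ incl x ∣ ≢ fromℕ n
incl≁top x = Fin.fromℕ≢inject₁ ∘ sym

data InclView {n : ℕ} : ±[ suc n ] → Set where
  is-top  : InclView top
  is-ntop : InclView (neg top)
  is-incl : ∀ x → InclView (incl x)

inclView : (x : ±[ suc n ]) → InclView x
inclView (s , k) with view k
inclView (Sign.+ , _) | ‵fromℕ = is-top
inclView (Sign.- , _) | ‵fromℕ = is-ntop
inclView (s , _) | ‵inj₁ {i = i} _ = is-incl (s , i)

≈-from-incl : (u w : SD (suc n)) → SD.to u top ≡ SD.to w top →
              (∀ x → SD.to u (incl x) ≡ SD.to w (incl x)) → u ≈ w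
≈-from-incl u w at-top at-incl x with inclView x
... | is-top    = at-top
... | is-ntop   = trans (SD.odd u top) (trans (cong neg at-top) (sym (SD.odd w top)))
... | is-incl y = at-incl y

insert-from-incl : (w : SignedPerm n) (p : ±[ suc n ]) (x : ±[ n ]) →
  SignedPerm.from (insert w p) (incl x) ≡
    (proj₁ (SignedPerm.from w x) , punchIn ∣ p ∣ ∣ SignedPerm.from w x ∣)
insert-from-incl w p (s , i) rewrite view-inject₁ i = refl

insert-from-top : (w : SignedPerm n) (p : ±[ suc n ]) → SignedPerm.from (insert w p) top ≡ p
insert-from-top {n} w p rewrite view-fromℕ n = refl

punchIn-fromℕ : (i : Fin n) → punchIn (fromℕ n) i ≡ inject₁ i
punchIn-fromℕ zero    = refl
punchIn-fromℕ (suc i) = cong suc (punchIn-fromℕ i)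

-- Here u is u′ with a positive entry inserted at the end, which leaves the product of signs
-- unchanged. The agreement is checked on inverses first, where the hypotheses apply directly.
signProduct-restrict : (u : SignedPerm (suc n)) (u′ : SignedPerm n) → SignedPerm.from u top ≡ top →
  (∀ x → SignedPerm.from u (incl x) ≡ incl (SignedPerm.from u′ x)) → signProduct u ≡ signProduct u′
signProduct-restrict {n} u u′ fixes-top from-incl =
  trans (sym (signProduct-cong v u agree)) (signProduct-insert u′ top)
  where
  v : SignedPerm (suc n)
  v = insert u′ top
  agree⁻ : ∀ {x} → InclView x → SignedPerm.from v x ≡ SignedPerm.from u x
  agree⁻ is-top      = trans (insert-from-top u′ top) (sym fixes-top)
  agree⁻ is-ntop     = trans (from-odd v top)
                         (trans (cong neg (trans (insert-from-top u′ top) (sym fixes-top)))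
                                (sym (from-odd u top)))
  agree⁻ (is-incl y) = trans (insert-from-incl u′ top y)
                         (trans (cong (_ ,_) (punchIn-fromℕ _)) (sym (from-incl y)))
  agree : ∀ x → SignedPerm.to v x ≡ SignedPerm.to u x
  agree x = trans (cong (SignedPerm.to v)
                    (trans (sym (SignedPerm.strictlyInverseʳ u x)) (sym (agree⁻ (inclView (SignedPerm.to u x))))))
                  (SignedPerm.strictlyInverseˡ v _)

restrict : (u : SD (2 + n)) → SD.from u top ≡ top →
           ∃ λ (u′ : SD (1 + n)) → ∀ x → SD.to u (incl x) ≡ incl (SD.to u′ x)
restrict {n} u fixes-top = (u′ even: +⇒even u′ sign-u′) , to-incl
  where
  pre-incl : (y : ±[ 2 + n ]) → ∣ y ∣ ≢ fromℕ _ → ∃ λ x → y ≡ incl x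
  pre-incl y y≁top with inclView y
  ... | is-top    = contradiction refl y≁top
  ... | is-ntop   = contradiction refl y≁top
  ... | is-incl x = x , refl

  to-restrict : (x : ±[ 1 + n ]) → ∃ λ y → SD.to u (incl x) ≡ incl y
  to-restrict x = pre-incl _ λ eq → incl≁top x
    (to-abs⁻ u (incl x) top (trans eq (cong ∣_∣ (sym (from⇒to u fixes-top)))))

  from-restrict : (x : ±[ 1 + n ]) → ∃ λ y → SD.from u (incl x) ≡ incl y
  from-restrict x = pre-incl _ λ eq → incl≁top x
    (from-abs⁻ u (incl x) top (trans eq (cong ∣_∣ (sym fixes-top))))

  to-incl : ∀ x → SD.to u (incl x) ≡ incl (proj₁ (to-restrict x))
  to-incl x = proj₂ (to-restrict x)

  from-incl : ∀ x → SD.from u (incl x) ≡ incl (proj₁ (from-restrict x))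
  from-incl x = proj₂ (from-restrict x)

  u′ : SignedPerm (1 + n)
  u′ = record
    { perm = mk↔ₛ′ (proj₁ ∘ to-restrict) (proj₁ ∘ from-restrict)
        (λ x → incl-injective (trans (sym (to-incl _)) (from⇒to u (from-incl x))))
        (λ x → incl-injective (trans (sym (from-incl _)) (to⇒from u (to-incl x))))
    ; odd = λ x → incl-injective (trans (sym (to-incl (neg x)))
                    (trans (SD.odd u (incl x)) (cong neg (to-incl x))))
    }

  sign-u′ : signProduct u′ ≡ Sign.+
  sign-u′ = trans (sym (signProduct-restrict (SD.signedPerm u) u′ fixes-top from-incl))
                  (even⇒+ (SD.signedPerm u) (SD.even u))

-- Right multiplication by a generator moves the position of the largest value up
-- one step, so that value can be brought to the last position.
top-position-induction : (P : SD (2 + n) → Set) →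
  (∀ u → SD.from u top ≡ top → P u) →
  (∀ u i → SD.from u top <± SD.to (gen i) (SD.from u top) → P (u ∙ gen i) → P u) →
  ∀ u → P u
top-position-induction {n} P base step u = all (SD.from u top) u refl
  where
  Q : ±[ 2 + n ] → Set
  Q p = ∀ u → SD.from u top ≡ p → P u

  Q-step : ∀ i {p q} → SD.to (gen i) p ≡ q → p <± q → Q q → Q p
  Q-step i refl p<q Qq u refl = step u i p<q (Qq (u ∙ gen i) (gen-from i _))

  positive : ∀ i → Q (Sign.+ , i)
  positive = >-weakInduction (λ i → Q (Sign.+ , i)) base
    (λ i → Q-step (suc i) (IsSwap.at-a (gen-swap (suc i))) (lower<upper (suc i)))

  negative : ∀ i → Q (Sign.- , i)
  negative = <-weakInduction (λ i → Q (Sign.- , i))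
    -- s₀ carries position -1 up to 2, which is settled already. The remaining negative positions
    -- climb towards -1 by the other generators.
    (Q-step zero (IsSwap.at-a (gen-swap zero)) (lower<upper {n} zero) (positive (suc zero)))
    (λ i → Q-step (suc i) (IsSwap.at-b (IsSwap-neg (gen-swap (suc i))))
             (neg-anti (lower (suc i)) (upper (suc i)) (lower<upper (suc i))))

  all : ∀ p → Q p
  all (Sign.+ , i) = positive i
  all (Sign.- , i) = negative i

gen-incl : (i : Fin (2 + n)) (x : ±[ 2 + n ]) → SD.to (gen (inject₁ i)) (incl x) ≡ incl (SD.to (gen i) x)
gen-incl {n} i x = cases (gen-swap′ i)
  where
  gen-swap′ : (i : Fin (2 + n)) → IsSwap (gen (inject₁ i)) (incl (lower i)) (incl (upper i))
  gen-swap′ zero    = gen-swap zero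
  gen-swap′ (suc i) = gen-swap (suc (inject₁ i))
  cases : IsSwap (gen (inject₁ i)) (incl (lower i)) (incl (upper i)) →
          SD.to (gen (inject₁ i)) (incl x) ≡ incl (SD.to (gen i) x)
  cases h with ∣ x ∣ Fin.≟ ∣ lower i ∣ | ∣ x ∣ Fin.≟ ∣ upper i ∣
  ... | no p | no q = trans
    (IsSwap.fixes h (incl x) (p ∘ Fin.inject₁-injective) (q ∘ Fin.inject₁-injective))
    (cong incl (sym (IsSwap.fixes (gen-swap i) x p q)))
  ... | yes p | _ with same-abs x (lower i) p
  ...   | inj₁ refl = trans (IsSwap.at-a h) (cong incl (sym (IsSwap.at-a (gen-swap i))))
  ...   | inj₂ refl = trans (IsSwap.at-a (IsSwap-neg h)) (cong incl (sym (IsSwap.at-a (IsSwap-neg (gen-swap i)))))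
  cases h | no _ | yes p with same-abs x (upper i) p
  ...   | inj₁ refl = trans (IsSwap.at-b h) (cong incl (sym (IsSwap.at-b (gen-swap i))))
  ...   | inj₂ refl = trans (IsSwap.at-b (IsSwap-neg h)) (cong incl (sym (IsSwap.at-b (IsSwap-neg (gen-swap i)))))

gen-top : (i : Fin (2 + n)) → SD.to (gen (inject₁ i)) top ≡ top
gen-top zero    = refl
gen-top (suc i) = IsSwap.fixes (gen-swap (suc (inject₁ i))) top Fin.fromℕ≢inject₁ Fin.fromℕ≢inject₁

word-incl : (is : List (Fin (2 + n))) (x : ±[ 2 + n ]) →
            SD.to (word (map inject₁ is)) (incl x) ≡ incl (SD.to (word is) x)
word-incl []       x = refl
word-incl (i ∷ is) x = trans (cong (SD.to (gen (inject₁ i))) (word-incl is x)) (gen-incl i _)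

word-top : (is : List (Fin (2 + n))) → SD.to (word (map inject₁ is)) top ≡ top
word-top []       = refl
word-top (i ∷ is) = trans (cong (SD.to (gen (inject₁ i))) (word-top is)) (gen-top i)

word-∷ʳ : (is : List (Fin (2 + n))) (i : Fin (2 + n)) → word (is ++ i ∷ []) ≈ word is ∙ gen i
word-∷ʳ []       i x = refl
word-∷ʳ (j ∷ is) i x = cong (SD.to (gen j)) (word-∷ʳ is i x)

-- Evenness excludes the sign change, the only other signed permutation of one letter. This is the
-- base of the induction on rank.
SD1-trivial : (u : SD 1) (x : ±[ 1 ]) → SD.to u x ≡ x
SD1-trivial u (Sign.+ , zero) = to-1
  where
  to-1 : SD.to u (Sign.+ , zero) ≡ (Sign.+ , zero)
  to-1 with SD.to u (Sign.+ , zero) | even⇒+ (SD.signedPerm u) (SD.even u)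
  ... | Sign.+ , zero | _ = refl
  ... | Sign.- , zero | ()
SD1-trivial u (Sign.- , zero) = trans (SD.odd u (Sign.+ , zero)) (cong neg (SD1-trivial u (Sign.+ , zero)))

-- Induction on the rank: an element fixing the largest value restricts to the group one rank lower,
-- whose words lift along `inject₁`. Any other element is brought to this form by right
-- multiplication with generators.
generated : ∀ n (u : SD (2 + n)) → ∃ λ is → word is ≈ u
generated n = top-position-induction (λ u → ∃ λ is → word is ≈ u) (fixing-top n) step
  where
  fixing-top : ∀ n (u : SD (2 + n)) → SD.from u top ≡ top → ∃ λ is → word is ≈ u
  fixing-top zero u fix =
    let u′ , to-incl = restrict u fix
    in  [] , ≈-from-incl ε u (sym (from⇒to u fix))
               (λ x → sym (trans (to-incl x) (cong incl (SD1-trivial u′ x))))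
  fixing-top (suc n) u fix =
    let u′ , to-incl = restrict u fix
        is , is≈     = generated n u′
    in  map inject₁ is , ≈-from-incl (word (map inject₁ is)) u
          (trans (word-top is) (sym (from⇒to u fix)))
          (λ x → trans (word-incl is x) (trans (cong incl (is≈ x)) (sym (to-incl x))))

  step : ∀ u i → SD.from u top <± SD.to (gen i) (SD.from u top) →
         (∃ λ is → word is ≈ u ∙ gen i) → ∃ λ is → word is ≈ u
  step u i _ (is , is≈) = is ++ i ∷ [] ,
    λ x → trans (word-∷ʳ is i x) (trans (is≈ _) (cong (SD.to u) (gen-involutive i x)))

-- The weak order

-- Exchange is applied to a shortest word of u, so that the word it yields for t u is shorter than
-- ℓ(u) itself.
Inv⇒T_L : (u : SD (2 + n)) {a b : ±[ 2 + n ]} → ∣ a ∣ ≢ ∣ b ∣ → Inv u a b →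
          ∃ λ t → IsSwap t a b × T_L u t
Inv⇒T_L {n} u {a} {b} a≁b u-inv =
  let is , is≈                          = generated n u
      l , (is₀ , is₀≈ , len₀) , minimal = hasLength u is is≈
      t , reflection , t-swap , is′ , is′≈ , len =
        exchange is₀ a b a≁b (Inv-cong {u = u} {word is₀} (λ x → sym (is₀≈ x)) u-inv)
      tu≈                               = λ x → trans (is′≈ x) (cong (SD.to t) (is₀≈ x))
      k , tu-len                        = hasLength (t ∙ u) is′ tu≈
  in  t , t-swap , reflection , k , l , tu-len , ((is₀ , is₀≈ , len₀) , minimal) ,
      ℕ.≤-trans (s≤s (proj₂ tu-len is′ tu≈)) (ℕ.≤-reflexive (trans (sym len) len₀))

reflection-swap : {t : SD (2 + n)} → IsReflection t → ∃ λ a → ∃ λ b → ∣ a ∣ ≢ ∣ b ∣ × a <± b × IsSwap t a b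
reflection-swap {n} {t} (x , i , t≈) =
  [ (λ lt → _ , _ , lower≁upper i ∘ to-abs⁻ x (lower i) (upper i) , lt , t-swap)
  , (λ lt → _ , _ , lower≁upper i ∘ sym ∘ to-abs⁻ x (upper i) (lower i) , lt , IsSwap-sym t-swap)
  ]′ (<±-connex (SD.to x (lower i)) (SD.to x (upper i)) (lower≁upper i ∘ to-abs⁻ x (lower i) (upper i)))
  where
  t-swap : IsSwap t (SD.to x (lower i)) (SD.to x (upper i))
  t-swap = IsSwap-conj x (gen i) t≈ refl refl (gen-swap i)

infix 4 _⊑_
_⊑_ : SD n → SD n → Set
u ⊑ w = ∀ a b → ∣ a ∣ ≢ ∣ b ∣ → Inv u a b → Inv w a b

≤ᴿ⇒⊑ : (u w : SD (2 + n)) → u ≤ᴿ w → u ⊑ w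
≤ᴿ⇒⊑ u w u≤w a b a≁b u-inv =
  let t , t-swap , t∈ = Inv⇒T_L u a≁b u-inv
  in  ℓ<⇒Inv w a≁b (Inv.less {w = u} u-inv) t-swap (proj₂ (u≤w {t} t∈))

T_L-cong : (w : SD (2 + n)) {t t′ : SD (2 + n)} → t ≈ t′ → T_L w t → T_L w t′
T_L-cong w {t} {t′} t≈t′ ((x , i , eq) , k , l , k-len , rest) =
  (x , i , λ y → trans (sym (t≈t′ y)) (eq y)) ,
  k , l , HasLength-cong {u = t ∙ w} {t′ ∙ w} (λ y → t≈t′ _) k-len , rest

⊑⇒≤ᴿ : (u w : SD (2 + n)) → u ⊑ w → u ≤ᴿ w
⊑⇒≤ᴿ u w sub {t} (reflection , tu<u) =
  let a , b , a≁b , a<b , t-swap = reflection-swap {t = t} reflection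
      t′ , t′-swap , t′∈         = Inv⇒T_L w a≁b (sub a b a≁b (ℓ<⇒Inv u a≁b a<b t-swap tu<u))
  -- The inversion only returns some reflection `t′` exchanging a and b; it agrees with `t` because
  -- a swap is determined by its pair.
  in  T_L-cong w {t′} {t} (IsSwap-unique t′-swap t-swap) t′∈

IsJoin⊑ : SD n → SD n → SD n → Set
IsJoin⊑ u w j = u ⊑ j × w ⊑ j × (∀ z → u ⊑ z → w ⊑ z → j ⊑ z)

IsJoin⇒IsJoin⊑ : (u w j : SD (2 + n)) → IsJoin u w j → IsJoin⊑ u w j
IsJoin⇒IsJoin⊑ u w j (u≤j , w≤j , least) =
  ≤ᴿ⇒⊑ u j (λ {t} → u≤j {t}) , ≤ᴿ⇒⊑ w j (λ {t} → w≤j {t}) ,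
  λ z u⊑z w⊑z → ≤ᴿ⇒⊑ j z (λ {t} → least z (λ {t} → ⊑⇒≤ᴿ u z u⊑z {t}) (λ {t} → ⊑⇒≤ᴿ w z w⊑z {t}) {t})

IsJoin⊑⇒IsJoin : (u w j : SD (2 + n)) → IsJoin⊑ u w j → IsJoin u w j
IsJoin⊑⇒IsJoin u w j (u⊑j , w⊑j , least) =
  (λ {t} → ⊑⇒≤ᴿ u j u⊑j {t}) , (λ {t} → ⊑⇒≤ᴿ w j w⊑j {t}) ,
  λ z u≤z w≤z {t} → ⊑⇒≤ᴿ j z (least z (≤ᴿ⇒⊑ u z (λ {t} → u≤z {t})) (≤ᴿ⇒⊑ w z (λ {t} → w≤z {t}))) {t}

-- Restriction of the order of values to ±[n]

Before : SD (suc n) → ±[ n ] → ±[ n ] → Set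
Before w a b = SD.from w (incl a) <± SD.from w (incl b)

-- `w′` lists the smaller values in the same relative order as `w`, except that the order of a and
-- -a stays free: deleting the largest value may force a change of sign in the first entry to keep
-- evenness.
Restricts : SD (suc n) → SD n → Set
Restricts w w′ = ∀ a b → ∣ a ∣ ≢ ∣ b ∣ → SD.from w′ a <± SD.from w′ b → Before w a b

Restricts⁻ : (w : SD (suc n)) (w′ : SD n) → Restricts w w′ →
             ∀ a b → ∣ a ∣ ≢ ∣ b ∣ → Before w a b → SD.from w′ a <± SD.from w′ b
Restricts⁻ w w′ r a b a≁b a<b =
  [ id , (λ b<a → contradiction (r b a (a≁b ∘ sym) b<a) (<±-asym _ _ a<b)) ]′
    (<±-connex (SD.from w′ a) (SD.from w′ b) (a≁b ∘ from-abs⁻ w′ a b))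

chain-mono : (g : Fin (suc m) → ±[ n ]) → (∀ i → g (inject₁ i) <± g (suc i)) →
             ∀ i j → toℕ i ℕ.< toℕ j → g i <± g j
chain-mono g h zero    (suc zero)    _ = h zero
chain-mono g h zero    (suc (suc j)) _ =
  <±-trans (g zero) _ _ (h zero) (chain-mono (g ∘ suc) (h ∘ suc) zero (suc j) (s≤s z≤n))
chain-mono {suc m} g h (suc i) (suc j) (s≤s p) = chain-mono (g ∘ suc) (h ∘ suc) i j p

-- The hypotheses read f(-1) < f(2) and f(1) < f(2) < f(3) < .... Together with oddness they decide
-- all pairs with distinct absolute values, but not the order of f(-1) and f(1).
odd-mono : (f : ±[ 2 + m ] → ±[ n ]) → (∀ x → f (neg x) ≡ neg (f x)) →
           (∀ i → f (lower i) <± f (upper i)) →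
           ∀ a b → ∣ a ∣ ≢ ∣ b ∣ → a <± b → f a <± f b
odd-mono {m} f f-odd h = mono
  where
  positive : ∀ i j → toℕ i ℕ.< toℕ j → f (Sign.+ , i) <± f (Sign.+ , j)
  positive = chain-mono (λ i → f (Sign.+ , i)) (h ∘ suc)

  -- f (−1) < f (2) ≤ f (j) for j ≥ 2
  from-1 : ∀ j → f (Sign.- , zero) <± f (Sign.+ , suc j)
  from-1 zero    = h zero
  from-1 (suc j) = <±-trans (f (Sign.- , zero)) _ _ (h zero) (positive (suc zero) (suc (suc j)) (s≤s (s≤s z≤n)))

  negate : ∀ a b → f (neg b) <± f (neg a) → f a <± f b
  negate a b lt = neg-cancel (f a) (f b) (subst₂ _<±_ (f-odd b) (f-odd a) lt)

  to-1 : ∀ i → f (Sign.- , suc i) <± f (Sign.+ , zero)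
  to-1 i = negate (Sign.- , suc i) (Sign.+ , zero) (from-1 i)

  mono : ∀ a b → ∣ a ∣ ≢ ∣ b ∣ → a <± b → f a <± f b
  mono (Sign.+ , i) (Sign.+ , j) _ (+<+ (s≤s p)) = positive i j p
  mono (Sign.- , i) (Sign.- , j) _ (-<- p) = negate (Sign.- , i) (Sign.- , j) (positive j i p)
  mono (Sign.- , zero) (Sign.+ , zero) a≁b _ = contradiction refl a≁b
  mono (Sign.- , zero) (Sign.+ , suc j) _ _ = from-1 j
  mono (Sign.- , suc i) (Sign.+ , zero) _ _ = to-1 i
  mono (Sign.- , suc i) (Sign.+ , suc j) _ _ =
    <±-trans (f (Sign.- , suc i)) _ _ (to-1 i) (positive zero (suc j) (s≤s z≤n))

lower-incl : (i : Fin (2 + n)) → lower (inject₁ i) ≡ incl (lower i)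
lower-incl zero    = refl
lower-incl (suc i) = refl

upper-incl : (i : Fin (2 + n)) → upper (inject₁ i) ≡ incl (upper i)
upper-incl zero    = refl
upper-incl (suc i) = refl

-- As v = s (s v) is shorter than s v, the pair of s is inverted in s v, hence stands in its natural
-- order in v.
ascent : (v : SD (2 + n)) (i : Fin (2 + n)) → v ℓ< (gen i ∙ v) →
         SD.from v (lower i) <± SD.from v (upper i)
ascent v i (k , l , v-len , sv-len , k<l) = subst₂ (λ x y → SD.from v x <± SD.from v y)
  (trans (gen-from i _) (IsSwap.at-b (gen-swap i)))
  (trans (gen-from i _) (IsSwap.at-a (gen-swap i)))
  (Inv.inverted (ℓ<⇒Inv (gen i ∙ v) (lower≁upper i) (lower<upper i) (gen-swap i)
    (k , l , HasLength-cong {u = v} {gen i ∙ (gen i ∙ v)} (λ x → sym (gen-involutive i _)) v-len , sv-len , k<l)))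

embed-from-incl : (w : SD (suc n)) (x : ±[ suc n ]) → SD.from (embed w) (incl x) ≡ incl (SD.from w x)
embed-from-incl w x = trans (insert-from-incl (SD.signedPerm w) top x) (cong (_ ,_) (punchIn-fromℕ _))

-- Positions in u = u′ v are positions in u′ followed by `SD.from v`. The ascents of v say that this
-- second map is increasing.
projection-restricts : (u : SD (3 + n)) (u′ : SD (2 + n)) → IsParabolicProjection u u′ → Restricts u u′
projection-restricts u u′ (v , u≈ , ascents) a b a≁b lt = subst₂ _<±_ (sym (from-u a)) (sym (from-u b))
  (odd-mono (SD.from v ∘ incl) (λ x → from-odd (SD.signedPerm v) (incl x))
    (λ i → subst₂ (λ x y → SD.from v x <± SD.from v y) (lower-incl i) (upper-incl i) (ascent v (inject₁ i) (ascents i)))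
    (SD.from u′ a) (SD.from u′ b) (a≁b ∘ from-abs⁻ u′ a b) lt)
  where
  from-u : ∀ x → SD.from u (incl x) ≡ SD.from v (incl (SD.from u′ x))
  from-u x = trans (from-cong {u = u} {embed u′ ∙ v} u≈ (incl x)) (cong (SD.from v) (embed-from-incl u′ x))

-- Moving the largest value by sᵢ does not reorder the others: the positions of a reordered pair
-- would be the ones sᵢ exchanges, up to negation, and the largest value would stay where it is.
restriction : (z : SD (2 + n)) → ∃ λ z′ → Restricts z z′
restriction {n} = top-position-induction (λ z → ∃ λ z′ → Restricts z z′) base step
  where
  base : (z : SD (2 + n)) → SD.from z top ≡ top → ∃ λ z′ → Restricts z z′
  base z fix =
    let z′ , to-incl = restrict z fix
        from-incl    = λ x → to⇒from z (trans (to-incl (SD.from z′ x)) (cong incl (SD.strictlyInverseˡ z′ x)))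
    in  z′ , λ a b _ lt → subst₂ _<±_ (sym (from-incl a)) (sym (from-incl b)) (incl-mono _ _ lt)

  step : ∀ z i → SD.from z top <± SD.to (gen i) (SD.from z top) →
         (∃ λ z′ → Restricts (z ∙ gen i) z′) → ∃ λ z′ → Restricts z z′
  step z i p<sp (z′ , r) = z′ , λ a b a≁b lt → [ id ,
    (λ b<a → contradiction (subst (SD.from z top <±_) (fixed a b
        (gen-inversion i _ _ (a≁b ∘ Fin.inject₁-injective ∘ from-abs⁻ z _ _ ∘ sym) b<a
          (subst₂ _<±_ (gen-from i _) (gen-from i _) (r a b a≁b lt)))) p<sp)
      (ℤ.<-irrefl refl)) ]′
    (<±-connex (SD.from z (incl a)) (SD.from z (incl b)) (a≁b ∘ Fin.inject₁-injective ∘ from-abs⁻ z _ _))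
    where
    fixed : ∀ a b → IsSwap (gen i) (SD.from z (incl b)) (SD.from z (incl a)) →
            SD.to (gen i) (SD.from z top) ≡ SD.from z top
    fixed a b h = IsSwap.fixes h _ (incl≁top b ∘ sym ∘ from-abs⁻ z _ _) (incl≁top a ∘ sym ∘ from-abs⁻ z _ _)

-- The weak order in terms of the restricted order and the values to the right of the largest one

Right : SD (suc n) → ±[ n ] → Set
Right w k = k RightOfTopIn w

incl<top : (k : ±[ n ]) → incl k <± top
incl<top (Sign.- , i) = -<+
incl<top {n} (Sign.+ , i) rewrite toℕ-inject₁ i | Fin.toℕ-fromℕ n = +<+ (s<s (Fin.toℕ<n i))

⊑⇒Right : (u w : SD (suc n)) → u ⊑ w → ∀ k → Right u k → Right w k
⊑⇒Right u w u⊑w k r = Inv.inverted {w = w} (u⊑w (incl k) top (incl≁top k) (inv (incl<top k) r))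

incl-cancel : (a b : ±[ n ]) → incl a <± incl b → a <± b
incl-cancel (Sign.- , i) (Sign.- , j) p rewrite toℕ-inject₁ i | toℕ-inject₁ j = p
incl-cancel (Sign.- , i) (Sign.+ , j) -<+ = -<+
incl-cancel (Sign.+ , i) (Sign.+ , j) p rewrite toℕ-inject₁ i | toℕ-inject₁ j = p

⊑-intro : (u w : SD (suc n)) →
  (∀ a b → ∣ a ∣ ≢ ∣ b ∣ → a <± b → Before u b a → Before w b a) →
  (∀ k → Right u k → Right w k) → u ⊑ w
⊑-intro u w before right a b = sub {a} {b} (inclView a) (inclView b)
  where
  to-top : ∀ k → Inv u (incl k) top → Inv w (incl k) top
  to-top k (inv lt r) = inv lt (right k r)

  sub : ∀ {a b} → InclView a → InclView b → ∣ a ∣ ≢ ∣ b ∣ → Inv u a b → Inv w a b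
  sub is-top      is-top      a≁b _ = contradiction refl a≁b
  sub is-top      is-ntop     a≁b _ = contradiction refl a≁b
  sub is-ntop     is-top      a≁b _ = contradiction refl a≁b
  sub is-ntop     is-ntop     a≁b _ = contradiction refl a≁b
  sub is-top      (is-incl k) _ (inv lt _) = contradiction lt (<±-asym (incl k) top (incl<top k))
  sub is-ntop     (is-incl k) _ h = Inv-neg⁻ w (to-top (neg k) (Inv-neg u h))
  sub (is-incl k) is-top      _ h = to-top k h
  sub (is-incl k) is-ntop     _ (inv lt _) = contradiction (neg-cancel top (neg (incl k))
    (subst (_<± neg top) (sym (neg-involutive (incl k))) lt)) (<±-asym (incl (neg k)) top (incl<top (neg k)))
  sub (is-incl a) (is-incl b) a≁b (inv lt r) =
    inv lt (before a b (a≁b ∘ cong inject₁) (incl-cancel a b lt) r)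

-- Positions in j′ and in the elements obtained from it by insertion

flip : ±[ suc n ] → ±[ suc n ]
flip (s , zero)  = opposite s , zero
flip (s , suc i) = s , suc i

punch : Fin (suc n) → ±[ n ] → ±[ suc n ]
punch q (s , i) = s , punchIn q i

-- The position in j⁽ᵖ⁾ of the value at a given position of j′: for p < 0 the positions 1 and -1 are
-- exchanged first, then everything from ∣p∣ outwards makes room for the new entry.
place : ±[ 2 + n ] → ±[ suc n ] → ±[ 2 + n ]
place (Sign.+ , q) x = punch q x
place (Sign.- , q) x = punch q (flip x)

flipFirst-from : (w : SignedPerm (suc n)) (x : ±[ suc n ]) →
                 SignedPerm.from (flipFirst w) x ≡ flip (SignedPerm.from w x)
flipFirst-from w x with SignedPerm.from w x
... | s , zero  = refl
... | s , suc i = refl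

^-from-incl : (w : SD (suc n)) (p : ±[ 2 + n ]) (x : ±[ suc n ]) →
              SD.from (w ^⟨ p ⟩) (incl x) ≡ place p (SD.from w x)
^-from-incl w (Sign.+ , q) x = insert-from-incl (SD.signedPerm w) (Sign.+ , q) x
^-from-incl w (Sign.- , q) x = trans (insert-from-incl (flipFirst (SD.signedPerm w)) (Sign.- , q) x)
  (cong (punch q) (flipFirst-from (SD.signedPerm w) x))

^-from-top : (w : SD (suc n)) (p : ±[ 2 + n ]) → SD.from (w ^⟨ p ⟩) top ≡ p
^-from-top w (Sign.+ , q) = insert-from-top (SD.signedPerm w) (Sign.+ , q)
^-from-top w (Sign.- , q) = insert-from-top (flipFirst (SD.signedPerm w)) (Sign.- , q)

punchIn-mono-< : (q : Fin (suc n)) (i j : Fin n) → toℕ i ℕ.< toℕ j → toℕ (punchIn q i) ℕ.< toℕ (punchIn q j)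
punchIn-mono-< q i j i<j = ℕ.≰⇒> λ le → ℕ.<⇒≱ i<j (Fin.punchIn-cancel-≤ q j i le)

punch-mono : (q : Fin (suc n)) (a b : ±[ n ]) → a <± b → punch q a <± punch q b
punch-mono q (Sign.- , i) (Sign.- , j) (-<- p)       = -<- (punchIn-mono-< q j i p)
punch-mono q (Sign.- , i) (Sign.+ , j) -<+           = -<+
punch-mono q (Sign.+ , i) (Sign.+ , j) (+<+ (s≤s p)) = +<+ (s<s (punchIn-mono-< q i j p))

-- Only the neighbours -1 and 1 trade places, and `∣ a ∣ ≢ ∣ b ∣` excludes comparing these two.
flip-mono : (a b : ±[ suc n ]) → ∣ a ∣ ≢ ∣ b ∣ → a <± b → flip a <± flip b
flip-mono (s , zero) (t , zero) a≁b _ = contradiction refl a≁b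
flip-mono (Sign.- , zero) (Sign.+ , suc j) _ _ = +<+ (s<s (s≤s z≤n))
flip-mono (Sign.+ , zero) (Sign.+ , suc j) _ _ = -<+
flip-mono (Sign.- , zero) (Sign.- , suc j) _ (-<- ())
flip-mono (Sign.+ , suc i) (Sign.+ , zero) _ (+<+ (s≤s ()))
flip-mono (Sign.- , suc i) (Sign.- , zero) _ _ = -<+
flip-mono (Sign.- , suc i) (Sign.+ , zero) _ _ = -<- (s≤s z≤n)
flip-mono (s , suc i) (t , suc j) _ p = p

place-mono : (p : ±[ 2 + n ]) (a b : ±[ suc n ]) → ∣ a ∣ ≢ ∣ b ∣ → a <± b → place p a <± place p b
place-mono (Sign.+ , q) a b _   lt = punch-mono q a b lt
place-mono (Sign.- , q) a b a≁b lt = punch-mono q (flip a) (flip b) (flip-mono a b a≁b lt)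

^-restricts : (w : SD (suc n)) (p : ±[ 2 + n ]) → Restricts (w ^⟨ p ⟩) w
^-restricts w p a b a≁b lt = subst₂ _<±_ (sym (^-from-incl w p a)) (sym (^-from-incl w p b))
  (place-mono p _ _ (a≁b ∘ from-abs⁻ w a b) lt)

-- `Above p y` spells out `p <± place p y`.
Above : ±[ 2 + n ] → ±[ suc n ] → Set
Above (Sign.+ , q) (Sign.+ , i)     = toℕ q ℕ.≤ toℕ i
Above (Sign.+ , q) (Sign.- , i)     = ⊥
-- Position 1 is flipped to -1. This lies above -(q+1) unless q = 0, when the insertion pushes it
-- out to -2.
Above (Sign.- , q) (Sign.+ , zero)  = 0 ℕ.< toℕ q
Above (Sign.- , q) (Sign.+ , suc i) = ⊤
Above (Sign.- , q) (Sign.- , zero)  = ⊤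
Above (Sign.- , q) (Sign.- , suc i) = suc (toℕ i) ℕ.< toℕ q

punchIn-above : (q : Fin (suc n)) (i : Fin n) → toℕ q ℕ.≤ toℕ i → toℕ q ℕ.< toℕ (punchIn q i)
punchIn-above zero    i       _       = s≤s z≤n
punchIn-above (suc q) (suc i) (s≤s p) = s<s (punchIn-above q i p)

punchIn-above⁻ : (q : Fin (suc n)) (i : Fin n) → toℕ q ℕ.< toℕ (punchIn q i) → toℕ q ℕ.≤ toℕ i
punchIn-above⁻ zero    i       _       = z≤n
punchIn-above⁻ (suc q) (suc i) (s≤s p) = s≤s (punchIn-above⁻ q i p)

punchIn-below : (q : Fin (suc n)) (i : Fin n) → toℕ i ℕ.< toℕ q → toℕ (punchIn q i) ℕ.< toℕ q
punchIn-below (suc q) zero    _       = s≤s z≤n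
punchIn-below (suc q) (suc i) (s≤s p) = s<s (punchIn-below q i p)

punchIn-below⁻ : (q : Fin (suc n)) (i : Fin n) → toℕ (punchIn q i) ℕ.< toℕ q → toℕ i ℕ.< toℕ q
punchIn-below⁻ (suc q) zero    _       = s≤s z≤n
punchIn-below⁻ (suc q) (suc i) (s≤s p) = s<s (punchIn-below⁻ q i p)

Above⇒< : (p : ±[ 2 + n ]) (y : ±[ suc n ]) → Above p y → p <± place p y
Above⇒< (Sign.+ , q) (Sign.+ , i)     h = +<+ (s<s (punchIn-above q i h))
Above⇒< (Sign.- , q) (Sign.+ , zero)  h = -<- (punchIn-below q zero h)
Above⇒< (Sign.- , q) (Sign.+ , suc i) _ = -<+
Above⇒< (Sign.- , q) (Sign.- , zero)  _ = -<+
Above⇒< (Sign.- , q) (Sign.- , suc i) h = -<- (punchIn-below q (suc i) h)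

<⇒Above : (p : ±[ 2 + n ]) (y : ±[ suc n ]) → p <± place p y → Above p y
<⇒Above (Sign.+ , q) (Sign.+ , i)     (+<+ (s≤s h)) = punchIn-above⁻ q i h
<⇒Above (Sign.- , q) (Sign.+ , zero)  (-<- h)       = punchIn-below⁻ q zero h
<⇒Above (Sign.- , q) (Sign.+ , suc i) _             = tt
<⇒Above (Sign.- , q) (Sign.- , zero)  _             = tt
<⇒Above (Sign.- , q) (Sign.- , suc i) (-<- h)       = punchIn-below⁻ q (suc i) h

Right⇒Above : (w : SD (suc n)) (p : ±[ 2 + n ]) (k : ±[ suc n ]) → Right (w ^⟨ p ⟩) k → Above p (SD.from w k)
Right⇒Above w p k r = <⇒Above p _ (subst₂ _<±_ (^-from-top w p) (^-from-incl w p k) r)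

Above⇒Right : (w : SD (suc n)) (p : ±[ 2 + n ]) (k : ±[ suc n ]) → Above p (SD.from w k) → Right (w ^⟨ p ⟩) k
Above⇒Right w p k h = subst₂ _<±_ (sym (^-from-top w p)) (sym (^-from-incl w p k)) (Above⇒< p _ h)

-- Largest elements of decidable subsets of ±[n]

greatest : {P : Fin n → Set} → (∀ i → Dec (P i)) →
           (∃ λ i → P i × (∀ j → P j → toℕ j ℕ.≤ toℕ i)) ⊎ (∀ i → ¬ P i)
greatest {zero}  P? = inj₂ λ ()
greatest {suc n} {P} P? with greatest (P? ∘ suc)
... | inj₁ (i , Pi , maximal) = inj₁ (suc i , Pi , λ { zero _ → z≤n ; (suc j) Pj → s≤s (maximal j Pj) })
... | inj₂ ¬Psuc with P? zero
...   | yes P0 = inj₁ (zero , P0 , λ { zero _ → z≤n ; (suc j) Pj → contradiction Pj (¬Psuc j) })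
...   | no ¬P0 = inj₂ λ { zero → ¬P0 ; (suc j) → ¬Psuc j }

smallest : {P : Fin n → Set} → (∀ i → Dec (P i)) → ∀ i → P i →
           ∃ λ i → P i × (∀ j → P j → toℕ i ℕ.≤ toℕ j)
smallest P? zero P0 = zero , P0 , λ _ _ → z≤n
smallest P? (suc i) Pi with P? zero
... | yes P0 = zero , P0 , λ _ _ → z≤n
... | no ¬P0 with k , Pk , minimal ← smallest (P? ∘ suc) i Pi =
  suc k , Pk , λ { zero P0 → contradiction P0 ¬P0 ; (suc j) Pj → s≤s (minimal j Pj) }

-- A positive element of greatest index wins; failing that, a negative one of smallest index, whose
-- existence the given negative witness guarantees.
largest : {P : ±[ n ] → Set} → (∀ x → Dec (P x)) → ∀ i → P (Sign.- , i) → ∃ (IsLargest P)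
largest {P = P} P? i Pi with greatest (λ j → P? (Sign.+ , j))
... | inj₁ (k , Pk , maximal) = (Sign.+ , k) , Pk ,
  λ { (Sign.+ , j) Pj → +≤+ (s≤s (maximal j Pj)) ; (Sign.- , j) _ → -≤+ }
... | inj₂ ¬P+ with smallest (λ j → P? (Sign.- , j)) i Pi
...   | k , Pk , minimal = (Sign.- , k) , Pk ,
  λ { (Sign.+ , j) Pj → contradiction Pj (¬P+ j) ; (Sign.- , j) Pj → -≤- (minimal j Pj) }

-- Positions forced to lie above the largest admissible one

-- Admissibility read in positions of j′. `Forced` will hold the positions whose values are right of
-- n in u or w.
Covers : (±[ 2 + n ] → Set) → ±[ 3 + n ] → Set
Covers Forced q = ∀ y → Forced y → Above q y

-- `Z` stands for the positions whose values are right of n in a given upper bound. The hypothesis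
-- `opposite-end` supplies the step from x to -x, which `upward` cannot make.
module _ {Forced Z : ±[ 2 + n ] → Set} (forced? : ∀ y → Dec (Forced y)) (forced⊆Z : ∀ y → Forced y → Z y)
  (upward : ∀ x y → ∣ x ∣ ≢ ∣ y ∣ → x <± y → Forced x → Z y)
  (opposite-end : ∀ x y → ∣ x ∣ ≢ ∣ y ∣ → x <± y → y <± neg x → Forced x → Z (neg x))
  where

  -- If passing from p to q loses at most x, then x is forced: otherwise q would still cover
  -- everything forced, against the maximality of p.
  obstruction : ∀ {p} → IsLargest (Covers Forced) p → ∀ q → ¬ q ≤± p → ∀ x →
                (∀ y → Above p y → y ≡ x ⊎ Above q y) → Forced x
  obstruction (covers , maximal) q q≰p x step with forced? x
  ... | yes fx = fx
  ... | no ¬fx = contradiction (maximal q λ y fy →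
    [ (λ { refl → contradiction fy ¬fx }) , id ]′ (step y (covers y fy))) q≰p

  above-largest : ∀ p → IsLargest (Covers Forced) p → ∀ y → Above p y → Z y
  above-largest (Sign.+ , i) L (Sign.+ , m) i≤m with view i
  -- With n in the last position, nothing lies to its right.
  ... | ‵fromℕ = contradiction (subst (ℕ._≤ toℕ m) (Fin.toℕ-fromℕ _) i≤m) (ℕ.<⇒≱ (Fin.toℕ<n m))
  ... | ‵inj₁ {i = k} _ = reach (ℕ.m≤n⇒m<n∨m≡n k≤m)
    where
    k≤m : toℕ k ℕ.≤ toℕ m
    k≤m = subst (ℕ._≤ toℕ m) (toℕ-inject₁ k) i≤m
    fk : Forced (Sign.+ , k)
    -- Moving n one place to the right loses only the entry it steps over.
    fk = obstruction L (Sign.+ , suc k) (λ { (+≤+ (s≤s le)) → ℕ.<⇒≱ (inject₁<suc k) le }) (Sign.+ , k) step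
      where
      step : ∀ y → Above (Sign.+ , inject₁ k) y → y ≡ (Sign.+ , k) ⊎ Above (Sign.+ , suc k) y
      step (Sign.+ , j) le with ℕ.m≤n⇒m<n∨m≡n le
      ... | inj₁ lt = inj₂ (subst (ℕ._< toℕ j) (toℕ-inject₁ k) lt)
      ... | inj₂ eq = inj₁ (cong (Sign.+ ,_) (toℕ-injective (trans (sym eq) (toℕ-inject₁ k))))
    reach : toℕ k ℕ.< toℕ m ⊎ toℕ k ≡ toℕ m → Z (Sign.+ , m)
    reach (inj₁ lt) = upward (Sign.+ , k) (Sign.+ , m) (λ eq → ℕ.<-irrefl (cong toℕ eq) lt) (+<+ (s<s lt)) fk
    reach (inj₂ eq) = forced⊆Z _ (subst (λ i → Forced (Sign.+ , i)) (toℕ-injective eq) fk)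
  above-largest (Sign.- , zero) L y y-above = reach y y-above
    where
    step : ∀ y → Above (Sign.- , zero) y → y ≡ (Sign.- , zero) ⊎ Above (Sign.+ , suc zero) y
    step (Sign.+ , suc i) _ = inj₂ (s≤s z≤n)
    step (Sign.- , zero)  _ = inj₁ refl
    f-1 : Forced (Sign.- , zero)
    -- Above -1 lie -1, 2, 3, ..., and above 2 lie 2, 3, ..., so only -1 is lost.
    f-1 = obstruction L (Sign.+ , suc zero) (λ ()) (Sign.- , zero) step
    reach : ∀ y → Above (Sign.- , zero) y → Z y
    reach (Sign.+ , suc i) _ = upward (Sign.- , zero) (Sign.+ , suc i) (λ ()) -<+ f-1
    reach (Sign.- , zero)  _ = forced⊆Z _ f-1
  above-largest (Sign.- , suc zero) L y y-above = reach y y-above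
    where
    step₁ : ∀ y → Above (Sign.- , suc zero) y → y ≡ (Sign.+ , zero) ⊎ Above (Sign.- , zero) y
    step₁ (Sign.+ , zero)  _ = inj₁ refl
    step₁ (Sign.+ , suc i) _ = inj₂ tt
    step₁ (Sign.- , zero)  _ = inj₂ tt
    step₁ (Sign.- , suc i) (s≤s ())
    step₋₁ : ∀ y → Above (Sign.- , suc zero) y → y ≡ (Sign.- , zero) ⊎ Above (Sign.+ , zero) y
    step₋₁ (Sign.+ , i)     _ = inj₂ z≤n
    step₋₁ (Sign.- , zero)  _ = inj₁ refl
    step₋₁ (Sign.- , suc i) (s≤s ())
    -- Above -2 lie -1, 1, 2, .... Passing to -1 loses only 1, and passing to 1 loses only -1, so
    -- both are forced and need not be compared.
    f1 : Forced (Sign.+ , zero)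
    f1 = obstruction L (Sign.- , zero) (λ { (-≤- ()) }) (Sign.+ , zero) step₁
    f-1 : Forced (Sign.- , zero)
    f-1 = obstruction L (Sign.+ , zero) (λ ()) (Sign.- , zero) step₋₁
    reach : ∀ y → Above (Sign.- , suc zero) y → Z y
    reach (Sign.+ , zero)  _ = forced⊆Z _ f1
    reach (Sign.+ , suc i) _ = upward (Sign.+ , zero) (Sign.+ , suc i) (λ ()) (+<+ (s<s (s≤s z≤n))) f1
    reach (Sign.- , zero)  _ = forced⊆Z _ f-1
    reach (Sign.- , suc i) (s≤s ())
  above-largest (Sign.- , suc (suc k)) L y y-above = reach y y-above
    where
    step : ∀ y → Above (Sign.- , suc (suc k)) y → y ≡ (Sign.- , suc k) ⊎ Above (Sign.- , inject₁ (suc k)) y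
    step (Sign.+ , zero)  _ = inj₂ (s≤s z≤n)
    step (Sign.+ , suc i) _ = inj₂ tt
    step (Sign.- , zero)  _ = inj₂ tt
    step (Sign.- , suc i) (s≤s (s≤s le)) with ℕ.m≤n⇒m<n∨m≡n le
    ... | inj₁ lt = inj₂ (s≤s (subst (toℕ i ℕ.<_) (sym (toℕ-inject₁ k)) lt))
    ... | inj₂ eq = inj₁ (cong (λ i → Sign.- , suc i) (toℕ-injective eq))
    x : ±[ 2 + n ]
    x = Sign.- , suc k
    fx : Forced x
    -- From -(k+3) to -(k+2), the only entry stepped over is the one at x = -(k+2).
    fx = obstruction L (Sign.- , inject₁ (suc k)) (λ { (-≤- le) → ℕ.<⇒≱ (inject₁<suc (suc k)) le }) x step
    reach : ∀ y → Above (Sign.- , suc (suc k)) y → Z y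
    reach (Sign.+ , i) _ with suc k Fin.≟ i
    -- Here the target is -x. As ∣x∣ ≥ 2, position 1 lies strictly between x and -x and serves as
    -- the intermediate position.
    ... | yes refl = opposite-end x (Sign.+ , zero) (λ ()) -<+ (+<+ (s<s (s≤s z≤n))) fx
    ... | no x≁y   = upward x (Sign.+ , i) x≁y -<+ fx
    reach (Sign.- , zero) _ = upward x (Sign.- , zero) (λ ()) (-<- (s≤s z≤n)) fx
    reach (Sign.- , suc i) (s≤s (s≤s le)) with ℕ.m≤n⇒m<n∨m≡n le
    ... | inj₁ lt = upward x (Sign.- , suc i) (λ eq → ℕ.<-irrefl (cong toℕ (sym (Fin.suc-injective eq))) lt) (-<- (s<s lt)) fx
    ... | inj₂ eq = forced⊆Z _ (subst (λ i → Forced (Sign.- , suc i)) (toℕ-injective (sym eq)) fx)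

above? : (p : ±[ 2 + n ]) (y : ±[ suc n ]) → Dec (Above p y)
above? p y = map′ (<⇒Above p y) (Above⇒< p y) (toℤ p ℤ.<? toℤ (place p y))

-- With the negated largest value in the last window position, the largest value comes first in the
-- complete notation; hence some p is always admissible.
covers-everything : (y : ±[ 2 + n ]) → Above (Sign.- , fromℕ (2 + n)) y
covers-everything (Sign.+ , zero)  = s≤s z≤n
covers-everything (Sign.+ , suc i) = tt
covers-everything (Sign.- , zero)  = tt
covers-everything (Sign.- , suc i) = subst (suc (toℕ i) ℕ.<_) (sym (Fin.toℕ-fromℕ _)) (Fin.toℕ<n (suc i))

-- Comparing elements through their restrictions

noninversion : (x : SD (3 + n)) (x′ j′ : SD (2 + n)) → Restricts x x′ → x′ ⊑ j′ →
  ∀ a b → ∣ a ∣ ≢ ∣ b ∣ → a <± b → SD.from j′ a <± SD.from j′ b → Before x a b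
noninversion x x′ j′ r x′⊑j′ a b a≁b a<b lt = r a b a≁b (
  [ id , (λ gt → contradiction (Inv.inverted {w = j′} (x′⊑j′ a b a≁b (inv a<b gt))) (<±-asym (SD.from j′ a) (SD.from j′ b) lt)) ]′
  (<±-connex (SD.from x′ a) (SD.from x′ b) (a≁b ∘ from-abs⁻ x′ a b)))

⊑-restrict : (u z : SD (3 + n)) (u′ z′ : SD (2 + n)) → Restricts u u′ → Restricts z z′ → u ⊑ z → u′ ⊑ z′
⊑-restrict u z u′ z′ ru rz u⊑z = λ a b a≁b (inv a<b lt) →
  inv a<b (Restricts⁻ z z′ rz b a (a≁b ∘ sym) (Inv.inverted {w = z}
    (u⊑z (incl a) (incl b) (a≁b ∘ Fin.inject₁-injective)
      (inv (incl-mono a b a<b) (ru b a (a≁b ∘ sym) lt)))))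

⊑-extend : (u z : SD (3 + n)) (u′ z′ : SD (2 + n)) → Restricts u u′ → Restricts z z′ → u′ ⊑ z′ →
            (∀ k → Right u k → Right z k) → u ⊑ z
⊑-extend u z u′ z′ ru rz u′⊑z′ = ⊑-intro u z λ a b a≁b a<b lt →
  rz b a (a≁b ∘ sym) (Inv.inverted {w = z′} (u′⊑z′ a b a≁b
    (inv a<b (Restricts⁻ u u′ ru b a (a≁b ∘ sym) lt))))

-- The join and its minimality among upper bounds

module Joins (u w : SD (3 + n)) (u′ w′ j′ : SD (2 + n)) (ru : Restricts u u′) (rw : Restricts w w′)
             (join : IsJoin⊑ u′ w′ j′) where

  Forced : ±[ 2 + n ] → Set
  Forced y = Right u (SD.to j′ y) ⊎ Right w (SD.to j′ y)

  forced? : ∀ y → Dec (Forced y)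
  forced? y = (_ ℤ.<? _) ⊎-dec (_ ℤ.<? _)

  covers⇒admissible : ∀ p → Covers Forced p → Admissible u w (j′ ^⟨ p ⟩)
  covers⇒admissible p covers k Kk = Above⇒Right j′ p k (covers (SD.from j′ k)
    (subst (λ k → Right u k ⊎ Right w k) (sym (SD.strictlyInverseˡ j′ k)) Kk))

  admissible⇒covers : ∀ p → Admissible u w (j′ ^⟨ p ⟩) → Covers Forced p
  admissible⇒covers p adm y fy = subst (Above p) (SD.strictlyInverseʳ j′ y)
    (Right⇒Above j′ p (SD.to j′ y) (adm (SD.to j′ y) fy))

  largest-cover : ∃ (IsLargest (Covers Forced))
  largest-cover = largest (λ p → all±? λ y → forced? y →-dec above? p y) (fromℕ _) (λ y _ → covers-everything y)

  module Minimal (z : SD (3 + n)) (z′ : SD (2 + n)) (rz : Restricts z z′) (u⊑z : u ⊑ z) (w⊑z : w ⊑ z) where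

    j′⊑z′ : j′ ⊑ z′
    j′⊑z′ = proj₂ (proj₂ join) z′ (⊑-restrict u z u′ z′ ru rz u⊑z) (⊑-restrict w z w′ z′ rw rz w⊑z)

    Z : ±[ 2 + n ] → Set
    Z y = Right z (SD.to j′ y)

    forced⊆Z : ∀ y → Forced y → Z y
    forced⊆Z y = [ ⊑⇒Right u z u⊑z _ , ⊑⇒Right w z w⊑z _ ]′

    -- Non-inversions of j′ persist below it, inversions of j′ persist above it.
    dichotomy : ∀ x y → ∣ x ∣ ≢ ∣ y ∣ → x <± y →
      (Before u (SD.to j′ x) (SD.to j′ y) × Before w (SD.to j′ x) (SD.to j′ y)) ⊎
      Before z (SD.to j′ x) (SD.to j′ y)
    dichotomy x y x≁y x<y =
      [ (λ a<b → inj₁ (noninversion u u′ j′ ru (proj₁ join) a b a≁b a<b lt ,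
                       noninversion w w′ j′ rw (proj₁ (proj₂ join)) a b a≁b a<b lt))
      , (λ b<a → inj₂ (rz a b a≁b (Inv.inverted {w = z′} (j′⊑z′ b a (a≁b ∘ sym) (inv b<a lt)))))
      ]′ (<±-connex a b a≁b)
      where
      a = SD.to j′ x
      b = SD.to j′ y
      a≁b : ∣ a ∣ ≢ ∣ b ∣
      a≁b = x≁y ∘ to-abs⁻ j′ x y
      lt : SD.from j′ a <± SD.from j′ b
      lt = subst₂ _<±_ (sym (SD.strictlyInverseʳ j′ x)) (sym (SD.strictlyInverseʳ j′ y)) x<y

    right-trans : (v : SD (3 + n)) {a b : ±[ 2 + n ]} → Right v a → Before v a b → Right v b
    right-trans v {a} {b} = <±-trans (SD.from v top) (SD.from v (incl a)) (SD.from v (incl b))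

    upward : ∀ x y → ∣ x ∣ ≢ ∣ y ∣ → x <± y → Forced x → Z y
    upward x y x≁y x<y fx =
      [ (λ (bu , bw) → forced⊆Z y ([ (λ r → inj₁ (right-trans u r bu)) , (λ r → inj₂ (right-trans w r bw)) ]′ fx))
      , right-trans z (forced⊆Z x fx)
      ]′ (dichotomy x y x≁y x<y)

    Before-neg : (v : SD (3 + n)) (x y : ±[ 2 + n ]) →
      Before v (SD.to j′ (neg y)) (SD.to j′ (neg x)) → Before v (SD.to j′ x) (SD.to j′ y)
    Before-neg v x y lt = neg-cancel _ _ (subst₂ _<±_ (neg-incl y) (neg-incl x) lt)
      where
      neg-incl : ∀ x → SD.from v (incl (SD.to j′ (neg x))) ≡ neg (SD.from v (incl (SD.to j′ x)))
      neg-incl x = trans (cong (SD.from v ∘ incl) (SD.odd j′ x)) (from-odd (SD.signedPerm v) _)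

    -- Either some of ±y gives the claim through z, or x precedes y precedes −x in both u and w.
    opposite-end : ∀ x y → ∣ x ∣ ≢ ∣ y ∣ → x <± y → y <± neg x → Forced x → Z (neg x)
    opposite-end x y x≁y x<y y<-x fx =
      [ (λ (y-u , y-w) →
          [ (λ (-y-u , -y-w) → forced⊆Z (neg x) (
              [ (λ r → inj₁ (right-trans u (right-trans u r (Before-neg u x y -y-u)) y-u))
              , (λ r → inj₂ (right-trans w (right-trans w r (Before-neg w x y -y-w)) y-w)) ]′ fx))
          , right-trans z (upward x (neg y) x≁y x<-y fx)
          ]′ (dichotomy (neg y) (neg x) (x≁y ∘ sym) (neg-anti x y x<y)))
      , right-trans z (upward x y x≁y x<y fx)
      ]′ (dichotomy y (neg x) (x≁y ∘ sym) y<-x)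
      where
      x<-y : x <± neg y
      x<-y = subst (_<± neg y) (neg-involutive x) (neg-anti y (neg x) y<-x)

    minimal : ∀ p → IsLargest (Covers Forced) p → (j′ ^⟨ p ⟩) ⊑ z
    minimal p p-largest = ⊑-extend (j′ ^⟨ p ⟩) z j′ z′ (^-restricts j′ p) rz j′⊑z′ (λ k r →
      subst (Right z) (SD.strictlyInverseˡ j′ k)
        (above-largest forced? forced⊆Z upward opposite-end p p-largest (SD.from j′ k) (Right⇒Above j′ p k r)))

  isJoin : ∀ p → IsLargest (Covers Forced) p → IsJoin⊑ u w (j′ ^⟨ p ⟩)
  isJoin p p-largest =
    ⊑-extend u (j′ ^⟨ p ⟩) u′ j′ ru (^-restricts j′ p) (proj₁ join) (λ k → adm k ∘ inj₁) ,
    ⊑-extend w (j′ ^⟨ p ⟩) w′ j′ rw (^-restricts j′ p) (proj₁ (proj₂ join)) (λ k → adm k ∘ inj₂) ,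
    λ z u⊑z w⊑z → let z′ , rz = restriction z in Minimal.minimal z z′ rz u⊑z w⊑z p p-largest
    where
    adm : Admissible u w (j′ ^⟨ p ⟩)
    adm = covers⇒admissible p (proj₁ p-largest)

mainTheorem6 : ∀ (n : ℕ) (u w : SD (3 + n)) (u′ w′ j′ : SD (2 + n)) →
    IsParabolicProjection u u′ →
    IsParabolicProjection w w′ →
    IsJoin u′ w′ j′ →
    ∃ λ p → IsLargest (λ q → Admissible u w (j′ ^⟨ q ⟩)) p
          × IsJoin u w (j′ ^⟨ p ⟩)
mainTheorem6 n u w u′ w′ j′ u-proj w-proj join =
  let p , covers , maximal = largest-cover
  in  p , (covers⇒admissible p covers , λ q adm → maximal q (admissible⇒covers q adm)) ,
      IsJoin⊑⇒IsJoin u w (j′ ^⟨ p ⟩) (isJoin p (covers , maximal))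
  where open Joins u w u′ w′ j′ (projection-restricts u u′ u-proj) (projection-restricts w w′ w-proj)
             (IsJoin⇒IsJoin⊑ u′ w′ j′ join)
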